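{- Let $X$ be an indeterminate and let $n,r,s$ be three positive integers. Then $$\sum_{|\mu|=n}\frac{X^{l(\mu)-1}}{z_\mu}\left(\sum_{i=1}^{l(\mu)}(\mu_i)_r\,(\mu_i)_s\right)=\frac{r!\,s!}{r+s}\sum_{k=1}^{\min(n,r+s)}\binom{r+s}{s}_k\binom{X+n-1}{n-k},$$ where the sum on the left is over all partitions $\mu$ of $n$.
   Context: A partition $\mu=(\mu_1,\dots,\mu_l)$ is a finite weakly decreasing sequence of positive integers (its parts); $l(\mu)=l$ is its length and $|\mu|=\sum_i\mu_i$ its weight. For $i\ge1$, $m_i(\mu)$ is the number of $j$ with $\mu_j=i$, and $z_\mu=\prod_{i\ge1}i^{m_i(\mu)}\,m_i(\mu)!$. For $a$ a number and $j\ge 0$ an integer, $(a)_j=a(a+1)\cdots(a+j-1)$ denotes the raising factorial, with $(a)_0=1$. For a polynomial $Y$ in $X$ and an integer $j\ge0$, $\binom{Y}{j}=Y(Y-1)\cdots(Y-j+1)/j!$. For integers $N\ge 1$, $0\le p\le N$, $k\ge 0$, define $$\binom{N}{p}_k=\binom{N}{k}\;{}_3F_2\!\left[\begin{matrix}1-k,\,-p,\,p-N\\ 1-N,\,1\end{matrix};1\right]=\binom{N}{k}\sum_{j=0}^{\min(p,N-p)}\frac{(1-k)_j\,(-p)_j\,(p-N)_j}{(1-N)_j\,(1)_j\,j!}.$$ The sum is finite because $(-p)_j(p-N)_j=0$ for $j>\min(p,N-p)$, and the denominators are nonzero in the stated range. Here $\binom{N}{k}$ is the usual binomial coefficient, equal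 to $0$ for $k>N$. -}

module Defs where

open import Algebra.Bundles using (RawRing)
import Algebra.Definitions.RawSemiring as RawSemiringDefinitions
open import Data.Empty using (⊥-elim)
open import Data.Fin.Base using (Fin; toℕ)
open import Data.Fin.Properties using (toℕ<n)
open import Data.Integer.Base as ℤ using (ℤ; +_)
import Data.Integer.Properties as ℤₚ
open import Data.List.Base using (List; []; _∷_; [_]; _++_; map; foldr; filter; length; replicate; concatMap; upTo; allFin)
open import Data.List.Membership.Propositional using (_∈_; lose; find)
open import Data.List.Membership.Propositional.Properties using (∈-concatMap⁺; ∈-concatMap⁻; ∈-map⁺; ∈-map⁻; ∈-upTo⁺)
open import Data.List.Properties using (++-cancelˡ)
open import Data.List.Relation.Unary.All as All using (All; []; _∷_)
import Data.List.Relation.Unary.All.Properties as Allₚ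
open import Data.List.Relation.Unary.AllPairs as AllPairs using (AllPairs; []; _∷_)
import Data.List.Relation.Unary.AllPairs.Properties as AllPairsₚ
open import Data.List.Relation.Unary.Any using (here)
open import Data.List.Relation.Unary.Linked using (Linked)
open import Data.List.Relation.Unary.Linked.Properties using (Linked⇒AllPairs; AllPairs⇒Linked)
open import Data.List.Relation.Unary.Unique.Propositional using (Unique)
import Data.List.Relation.Unary.Unique.Propositional.Properties as Uniqueₚ
open import Data.Nat.Base as ℕ using (ℕ; zero; suc; _≤_; _<_; _≥_; _∸_; _⊓_; _^_; _!; NonZero; z≤n; s≤s)
open import Data.Nat.Combinatorics using (_C_)
open import Data.Nat.DivMod using (m*n/n≡m; /-monoˡ-≤; m/n*n≤m)
open import Data.Nat.ListAction using (sum; product)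
open import Data.Nat.ListAction.Properties using (product≢0; sum-++)
open import Data.Nat.Coprimality as Coprimality using (1-coprimeTo)
import Data.Nat.Properties as ℕₚ
open import Data.Product.Base using (_×_; _,_; ∃₂)
open import Data.Rational.Base as ℚ using (ℚ; 0ℚ; 1ℚ; mkℚ; _/_; _÷_)
import Data.Rational.Properties as ℚₚ
open import Function.Base using (_∘_)
open import Function.Bundles using (_⇔_; mk⇔)
open import Level using (0ℓ)
open import Relation.Binary.PropositionalEquality hiding ([_])
open import Relation.Nullary using (yes; no)

range₁ : ℕ → List ℕ
range₁ n = map suc (upTo n)

infix 5 ∑ℚ-syntax

∑ℚ-syntax : ∀ {a} {A : Set a} → List A → (A → ℚ) → ℚ
∑ℚ-syntax xs f = foldr ℚ._+_ 0ℚ (map f xs)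

syntax ∑ℚ-syntax xs (λ x → t) = ∑ℚ[ x ∈ xs ] t

fromℤ : ℤ → ℚ
fromℤ i = i / 1

fromℕ : ℕ → ℚ
fromℕ n = fromℤ (+ n)

+-nonZero : ∀ m n .{{_ : NonZero m}} → NonZero (m ℕ.+ n)
+-nonZero (suc _) _ = _

record IsPartition (n : ℕ) (μ : List ℕ) : Set where
  field
    decreasing : Linked _≥_ μ
    positive   : All NonZero μ
    weight     : sum μ ≡ n

-- The partitions of n all of whose parts are at most m, enumerated by
-- the multiplicity k of m as a part.
partitionsUpTo : ℕ → ℕ → List (List ℕ)
partitionsUpTo zero    zero    = [ [] ]
partitionsUpTo zero    (suc _) = []
partitionsUpTo (suc m) n       =
  concatMap (λ k → map (replicate k (suc m) ++_) (partitionsUpTo m (n ∸ k ℕ.* suc m)))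
            (upTo (suc (n ℕ./ suc m)))

partitions : ℕ → List (List ℕ)
partitions n = partitionsUpTo n n

multiplicity : ℕ → List ℕ → ℕ
multiplicity i μ = length (filter (ℕₚ._≟ i) μ)

-- No part exceeds sum μ, so the factors with i > sum μ are all 1.
z : List ℕ → ℕ
z μ = product (map (λ i → i ^ multiplicity i μ ℕ.* multiplicity i μ !) (range₁ (sum μ)))

z-nonZero : ∀ μ → NonZero (z μ)
z-nonZero μ = product≢0 (Allₚ.map⁺ (Allₚ.map⁺ (All.universal factor (upTo (sum μ)))))
  where
  factor : ∀ i → NonZero (suc i ^ multiplicity (suc i) μ ℕ.* multiplicity (suc i) μ !)
  factor i = ℕₚ.m*n≢0 _ _ {{ℕₚ.m^n≢0 (suc i) (multiplicity (suc i) μ)}}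
                          {{multiplicity (suc i) μ ℕₚ.!≢0}}

1/z : List ℕ → ℚ
1/z μ = + 1 / z μ
  where
  instance
    zμ-nonZero : NonZero (z μ)
    zμ-nonZero = z-nonZero μ

private

  record IsPartitionUpTo (m n : ℕ) (μ : List ℕ) : Set where
    constructor mk
    field
      pairs    : AllPairs _≥_ μ
      bounded  : All (_≤ m) μ
      positive : All NonZero μ
      weight   : sum μ ≡ n

  sum-replicate : ∀ k a → sum (replicate k a) ≡ k ℕ.* a
  sum-replicate zero    a = refl
  sum-replicate (suc k) a = cong (a ℕ.+_) (sum-replicate k a)

  sum-replicate-++ : ∀ k a ν → sum (replicate k a ++ ν) ≡ k ℕ.* a ℕ.+ sum ν
  sum-replicate-++ k a ν =
    trans (sum-++ (replicate k a) ν) (cong (ℕ._+ sum ν) (sum-replicate k a))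

  prepend : ∀ k {m n ν} → IsPartitionUpTo m n ν →
            IsPartitionUpTo (suc m) (k ℕ.* suc m ℕ.+ n) (replicate k (suc m) ++ ν)
  prepend k {m} {n} {ν} (mk p b +ve w) = mk
    (pairs k)
    (Allₚ.++⁺ (Allₚ.replicate⁺ k ℕₚ.≤-refl) (All.map ℕₚ.m≤n⇒m≤1+n b))
    (Allₚ.++⁺ (Allₚ.replicate⁺ k _) +ve)
    (trans (sum-replicate-++ k (suc m) ν) (cong (k ℕ.* suc m ℕ.+_) w))
    where
    pairs : ∀ k → AllPairs _≥_ (replicate k (suc m) ++ ν)
    pairs zero    = p
    pairs (suc k) = Allₚ.++⁺ (Allₚ.replicate⁺ k ℕₚ.≤-refl) (All.map ℕₚ.m≤n⇒m≤1+n b) ∷ pairs k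

  upTo-≤ : ∀ n → All (_≤ n) (upTo (suc n))
  upTo-≤ n = Allₚ.applyUpTo⁺₁ (λ i → i) (suc n) ℕ.s≤s⁻¹

  sound : ∀ m n {μ} → μ ∈ partitionsUpTo m n → IsPartitionUpTo m n μ
  sound zero    zero    (here refl) = mk [] [] [] refl
  sound (suc m) n       μ∈ with find (∈-concatMap⁻ _ {xs = upTo (suc (n ℕ./ suc m))} μ∈)
  ... | k , k∈ , μ∈ₖ with ∈-map⁻ _ μ∈ₖ
  ...   | ν , ν∈ , refl = subst (λ w → IsPartitionUpTo (suc m) w _) (ℕₚ.m+[n∸m]≡n k*m≤n)
                                (prepend k (sound m (n ∸ k ℕ.* suc m) ν∈))
    where
    k*m≤n : k ℕ.* suc m ≤ n
    k*m≤n = ℕₚ.≤-trans (ℕₚ.*-monoˡ-≤ (suc m) (All.lookup (upTo-≤ (n ℕ./ suc m)) k∈))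
                       (m/n*n≤m n (suc m))

  split : ∀ m {μ} → AllPairs _≥_ μ → All (_≤ suc m) μ → All NonZero μ →
          ∃₂ λ k ν → μ ≡ replicate k (suc m) ++ ν × IsPartitionUpTo m (sum ν) ν
  split m []            []       []         = 0 , [] , refl , mk [] [] [] refl
  split m {x ∷ μ} (x≥ ∷ p) (x≤ ∷ b) (+x ∷ +ve) with x ℕₚ.≟ suc m
  ... | yes refl with split m p b +ve
  ...   | k , ν , refl , ν-part = suc k , ν , refl , ν-part
  split m {x ∷ μ} (x≥ ∷ p) (x≤ ∷ b) (+x ∷ +ve) | no x≢ =
    0 , x ∷ μ , refl , mk (x≥ ∷ p) (x≤m ∷ All.map (λ y≤x → ℕₚ.≤-trans y≤x x≤m) x≥) (+x ∷ +ve) refl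
    where
    x≤m : x ≤ m
    x≤m = ℕ.s≤s⁻¹ (ℕₚ.≤∧≢⇒< x≤ x≢)

  complete : ∀ m n {μ} → IsPartitionUpTo m n μ → μ ∈ partitionsUpTo m n
  complete zero    _ (mk _ [] _ refl)                     = here refl
  complete zero    _ (mk _ (z≤n ∷ _) (() ∷ _) _)
  complete (suc m) _ (mk p b +ve refl) with split m p b +ve
  ... | k , ν , refl , ν-part =
    ∈-concatMap⁺ _ (lose (∈-upTo⁺ (s≤s k≤)) (∈-map⁺ (replicate k (suc m) ++_) ν∈))
    where
    total : ℕ
    total = sum (replicate k (suc m) ++ ν)
    total≡ : total ≡ k ℕ.* suc m ℕ.+ sum ν
    total≡ = sum-replicate-++ k (suc m) ν
    k≤ : k ≤ total ℕ./ suc m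
    k≤ = subst (_≤ total ℕ./ suc m) (m*n/n≡m k (suc m))
           (/-monoˡ-≤ (suc m) (subst (k ℕ.* suc m ≤_) (sym total≡) (ℕₚ.m≤m+n _ _)))
    ν∈ : ν ∈ partitionsUpTo m (total ∸ k ℕ.* suc m)
    ν∈ = subst (λ w → ν ∈ partitionsUpTo m w)
           (sym (trans (cong (_∸ k ℕ.* suc m) total≡) (ℕₚ.m+n∸m≡n (k ℕ.* suc m) (sum ν))))
           (complete m (sum ν) ν-part)

  multiplicity-unique : ∀ {m} j k {ν ν′} → All (_≤ m) ν → All (_≤ m) ν′ →
                        replicate j (suc m) ++ ν ≡ replicate k (suc m) ++ ν′ → j ≡ k
  multiplicity-unique zero    zero    _ _ _ = refl
  multiplicity-unique zero    (suc k) (m<m ∷ _) _ refl = ⊥-elim (ℕₚ.<-irrefl refl m<m)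
  multiplicity-unique (suc j) zero    _ (m<m ∷ _) refl = ⊥-elim (ℕₚ.<-irrefl refl m<m)
  multiplicity-unique (suc j) (suc k) b b′ eq =
    cong suc (multiplicity-unique j k b b′ (++-cancelˡ [ _ ] _ _ eq))

  unique : ∀ m n → Unique (partitionsUpTo m n)
  unique zero    zero    = [] ∷ []
  unique zero    (suc _) = []
  unique (suc m) n       = Uniqueₚ.concat⁺
    (Allₚ.map⁺ (All.universal
      (λ k → Uniqueₚ.map⁺ (++-cancelˡ (replicate k (suc m)) _ _) (unique m (n ∸ k ℕ.* suc m)))
      (upTo (suc (n ℕ./ suc m)))))
    (AllPairsₚ.map⁺ (AllPairs.map disjoint (Uniqueₚ.upTo⁺ (suc (n ℕ./ suc m)))))
    where
    block : ℕ → List (List ℕ)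
    block k = map (replicate k (suc m) ++_) (partitionsUpTo m (n ∸ k ℕ.* suc m))
    disjoint : ∀ {j k} → j ≢ k → ∀ {μ} → μ ∈ block j × μ ∈ block k → _
    disjoint {j} {k} j≢k (μ∈j , μ∈k) with ∈-map⁻ _ μ∈j | ∈-map⁻ _ μ∈k
    ... | ν , ν∈ , refl | ν′ , ν′∈ , eq =
      j≢k (multiplicity-unique j k (IsPartitionUpTo.bounded (sound m (n ∸ j ℕ.* suc m) ν∈))
                                   (IsPartitionUpTo.bounded (sound m (n ∸ k ℕ.* suc m) ν′∈)) eq)

  parts≤sum : ∀ μ → All (_≤ sum μ) μ
  parts≤sum []      = []
  parts≤sum (x ∷ μ) =
    ℕₚ.m≤m+n x (sum μ) ∷ All.map (λ y≤ → ℕₚ.≤-trans y≤ (ℕₚ.m≤n+m (sum μ) x)) (parts≤sum μ)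

∈-partitions⇔ : ∀ n μ → μ ∈ partitions n ⇔ IsPartition n μ
∈-partitions⇔ n μ = mk⇔ to from
  where
  to : μ ∈ partitions n → IsPartition n μ
  to μ∈ with sound n n μ∈
  ... | mk p _ +ve w = record { decreasing = AllPairs⇒Linked p ; positive = +ve ; weight = w }
  from : IsPartition n μ → μ ∈ partitions n
  from record { decreasing = d ; positive = +ve ; weight = refl } =
    complete n n (mk (Linked⇒AllPairs (λ y≤x z≤y → ℕₚ.≤-trans z≤y y≤x) d) (parts≤sum μ) +ve refl)

partitions-unique : ∀ n → Unique (partitions n)
partitions-unique n = unique n n

rising : ℚ → ℕ → ℚ
rising a zero    = 1ℚ
rising a (suc j) = rising a j ℚ.* (a ℚ.+ fromℕ j)

private

  fromℤ≡mkℚ : ∀ i → fromℤ i ≡ mkℚ i 0 (Coprimality.sym (1-coprimeTo ℤ.∣ i ∣))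
  fromℤ≡mkℚ i = ℚₚ.↥p/↧p≡p (mkℚ i 0 _)

  fromℤ-injective : ∀ {i j} → fromℤ i ≡ fromℤ j → i ≡ j
  fromℤ-injective {i} {j} eq =
    cong ℚ.numerator (trans (sym (fromℤ≡mkℚ i)) (trans eq (fromℤ≡mkℚ j)))

  1+fromℕ : ∀ n → 1ℚ ℚ.+ fromℕ n ≡ fromℕ (suc n)
  1+fromℕ n = trans (cong (1ℚ ℚ.+_) (fromℤ≡mkℚ (+ n)))
                    (cong (λ i → (+ 1 ℤ.+ i) / 1) (ℤₚ.*-identityʳ (+ n)))

  *-≢0 : ∀ {p q} → p ≢ 0ℚ → q ≢ 0ℚ → p ℚ.* q ≢ 0ℚ
  *-≢0 {p} {q} p≢0 q≢0 pq≡0 = q≢0 (begin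
    q                        ≡⟨ ℚₚ.*-identityˡ q ⟨
    1ℚ ℚ.* q                 ≡⟨ cong (ℚ._* q) (ℚₚ.*-inverseˡ p) ⟨
    ((ℚ.1/ p) ℚ.* p) ℚ.* q   ≡⟨ ℚₚ.*-assoc (ℚ.1/ p) p q ⟩
    (ℚ.1/ p) ℚ.* (p ℚ.* q)   ≡⟨ cong ((ℚ.1/ p) ℚ.*_) pq≡0 ⟩
    (ℚ.1/ p) ℚ.* 0ℚ          ≡⟨ ℚₚ.*-zeroʳ (ℚ.1/ p) ⟩
    0ℚ                       ∎)
    where
    open ≡-Reasoning
    instance
      p-nonZero : ℚ.NonZero p
      p-nonZero = ℚ.≢-nonZero p≢0

  rising-≢0 : ∀ a j → (∀ {i} → i < j → a ℚ.+ fromℕ i ≢ 0ℚ) → rising a j ≢ 0ℚ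
  rising-≢0 a zero    _      = ℚₚ.1≢0
  rising-≢0 a (suc j) factor =
    *-≢0 (rising-≢0 a j (λ i<j → factor (ℕₚ.m≤n⇒m≤1+n i<j))) (factor ℕₚ.≤-refl)

  1-N-factor : ∀ N i → suc i < N → (1ℚ ℚ.- fromℕ N) ℚ.+ fromℕ i ≢ 0ℚ
  1-N-factor N i 1+i<N eq = ℕₚ.<⇒≢ 1+i<N (ℤₚ.+-injective (fromℤ-injective (begin
    fromℕ (suc i)                                 ≡⟨ 1+fromℕ i ⟨
    1ℚ ℚ.+ b                                      ≡⟨ cong (1ℚ ℚ.+_) (ℚₚ.+-identityˡ b) ⟨
    1ℚ ℚ.+ (0ℚ ℚ.+ b)                             ≡⟨ cong (λ t → 1ℚ ℚ.+ (t ℚ.+ b)) (ℚₚ.+-inverseˡ a) ⟨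
    1ℚ ℚ.+ ((ℚ.- a ℚ.+ a) ℚ.+ b)                  ≡⟨ cong (1ℚ ℚ.+_) (ℚₚ.+-assoc (ℚ.- a) a b) ⟩
    1ℚ ℚ.+ (ℚ.- a ℚ.+ (a ℚ.+ b))                  ≡⟨ cong (λ t → 1ℚ ℚ.+ (ℚ.- a ℚ.+ t)) (ℚₚ.+-comm a b) ⟩
    1ℚ ℚ.+ (ℚ.- a ℚ.+ (b ℚ.+ a))                  ≡⟨ ℚₚ.+-assoc 1ℚ (ℚ.- a) (b ℚ.+ a) ⟨
    (1ℚ ℚ.- a) ℚ.+ (b ℚ.+ a)                      ≡⟨ ℚₚ.+-assoc (1ℚ ℚ.- a) b a ⟨
    ((1ℚ ℚ.- a) ℚ.+ b) ℚ.+ a                      ≡⟨ cong (ℚ._+ a) eq ⟩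
    0ℚ ℚ.+ a                                      ≡⟨ ℚₚ.+-identityˡ a ⟩
    a                                             ∎)))
    where
    open ≡-Reasoning
    a b : ℚ
    a = fromℕ N
    b = fromℕ i

  1-factor : ∀ i → 1ℚ ℚ.+ fromℕ i ≢ 0ℚ
  1-factor i eq with fromℤ-injective {+ suc i} {+ 0} (trans (sym (1+fromℕ i)) eq)
  ... | ()

  p⊓[N∸p]<N : ∀ N p .{{_ : NonZero N}} → p ⊓ (N ∸ p) < N
  p⊓[N∸p]<N (suc N) zero    = s≤s z≤n
  p⊓[N∸p]<N (suc N) (suc p) = s≤s (ℕₚ.≤-trans (ℕₚ.m⊓n≤n (suc p) (N ∸ p)) (ℕₚ.m∸n≤m N p))

₃F₂-denominator : ℕ → ℕ → ℚ
₃F₂-denominator N j = rising (1ℚ ℚ.- fromℕ N) j ℚ.* rising 1ℚ j ℚ.* fromℕ (j !)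

₃F₂-denominator-nonZero : ∀ N j → j < N → ℚ.NonZero (₃F₂-denominator N j)
₃F₂-denominator-nonZero N j j<N = ℚ.≢-nonZero (*-≢0 (*-≢0
  (rising-≢0 _ j (λ {i} i<j → 1-N-factor N i (ℕₚ.<-≤-trans (s≤s i<j) j<N)))
  (rising-≢0 1ℚ j (λ {i} _ → 1-factor i)))
  (λ eq → ℕ.≢-nonZero⁻¹ (j !) {{j ℕₚ.!≢0}} (ℤₚ.+-injective (fromℤ-injective eq))))

-- (N C k) · ₃F₂[1-k, -p, p-N; 1-N, 1; 1], where the factor (-p)_j (p-N)_j
-- ends the series at j = min(p, N-p), before (1-N)_j can vanish.
-- Meaningful for p ≤ N only, where N ∸ p is the true difference.
binom : (N : ℕ) .{{_ : NonZero N}} (p k : ℕ) → ℚ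
binom N p k = fromℕ (N C k) ℚ.* (∑ℚ[ j ∈ allFin (suc (p ⊓ (N ∸ p))) ] term j)
  where
  term : Fin (suc (p ⊓ (N ∸ p))) → ℚ
  term i =
    (rising (1ℚ ℚ.- fromℕ k) j ℚ.* rising (ℚ.- fromℕ p) j ℚ.* rising (fromℕ p ℚ.- fromℕ N) j)
      ÷ ₃F₂-denominator N j
    where
    j : ℕ
    j = toℕ i
    instance
      denominator-nonZero : ℚ.NonZero (₃F₂-denominator N j)
      denominator-nonZero =
        ₃F₂-denominator-nonZero N j (ℕₚ.<-≤-trans (toℕ<n i) (p⊓[N∸p]<N N p))

-- The list a₀ ∷ a₁ ∷ … ∷ [] of coefficients, lowest degree first;
-- trailing zeros are allowed, hence the setoid equality _≈_.
ℚ[X] : Set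
ℚ[X] = List ℚ

coeff : ℚ[X] → ℕ → ℚ
coeff []      _       = 0ℚ
coeff (a ∷ f) zero    = a
coeff (a ∷ f) (suc i) = coeff f i

infix  4 _≈_
infixl 6 _⊕_ _⊖_
infixl 7 _⊗_
infixr 7 _·_

_≈_ : ℚ[X] → ℚ[X] → Set
f ≈ g = ∀ i → coeff f i ≡ coeff g i

_⊕_ : ℚ[X] → ℚ[X] → ℚ[X]
[]      ⊕ g       = g
(a ∷ f) ⊕ []      = a ∷ f
(a ∷ f) ⊕ (b ∷ g) = a ℚ.+ b ∷ f ⊕ g

_·_ : ℚ → ℚ[X] → ℚ[X]
a · f = map (a ℚ.*_) f

⊖_ : ℚ[X] → ℚ[X]
⊖ f = map ℚ.-_ f

_⊖_ : ℚ[X] → ℚ[X] → ℚ[X]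
f ⊖ g = f ⊕ (⊖ g)

_⊗_ : ℚ[X] → ℚ[X] → ℚ[X]
[]      ⊗ g = []
(a ∷ f) ⊗ g = (a · g) ⊕ (0ℚ ∷ f ⊗ g)

const : ℚ → ℚ[X]
const a = a ∷ []

X : ℚ[X]
X = 0ℚ ∷ 1ℚ ∷ []

ℚ[X]-rawRing : RawRing 0ℓ 0ℓ
ℚ[X]-rawRing = record
  { Carrier = ℚ[X]
  ; _≈_     = _≈_
  ; _+_     = _⊕_
  ; _*_     = _⊗_
  ; -_      = ⊖_
  ; 0#      = []
  ; 1#      = const 1ℚ
  }

open RawSemiringDefinitions (RawRing.rawSemiring ℚ[X]-rawRing) public
  using () renaming (_^_ to _^ₚ_)

infix 5 ∑-syntax

∑-syntax : ∀ {a} {A : Set a} → List A → (A → ℚ[X]) → ℚ[X]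
∑-syntax xs f = foldr _⊕_ [] (map f xs)

syntax ∑-syntax xs (λ x → t) = ∑[ x ∈ xs ] t

falling : ℚ[X] → ℕ → ℚ[X]
falling Y zero    = const 1ℚ
falling Y (suc j) = falling Y j ⊗ (Y ⊖ const (fromℕ j))

choose : ℚ[X] → ℕ → ℚ[X]
choose Y j = (+ 1 / j !) · falling Y j
  where
  instance
    j!-nonZero : NonZero (j !)
    j!-nonZero = j ℕₚ.!≢0

{-# OPTIONS --safe #-}
module Submission where

-- Evaluate both sides at x = a + 1 for a natural number a, which determines
-- a polynomial. Put H n = Σ_{|μ|=n} x^{l(μ)} / z_μ. Since m_m(μ) / z_μ is
-- 1 / (m z_ν) for ν = μ minus a part m,
--   Σ_{|μ|=n} x^{l(μ)} / z_μ Σ_i g(μ_i) = x Σ_{m=1}^n (g(m) / m) H (n - m)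
-- for every g. Taking g(m) = m gives n H n = x Σ_{i<n} H i, hence
-- H n = C(n + a, a). For g(m) = (m)_r (m)_s and i = m - 1, the identity
--   C(i+r, r) C(i+s, s) = Σ_j C(r, j) C(s, j) C(r+s+i-j, r+s)
-- and Vandermonde convolution show that g(m) / m is r! s! / (r+s) times
-- Σ_k binom (r+s) s k C(m-1, k-1), and a last Vandermonde convolution with
-- H turns C(m-1, k-1) into C(x+n-1, n-k).

open import Algebra.Bundles using (CommutativeRing)
import Algebra.Properties.Semiring.Exp as Exp
open import Data.Fin.Base as Fin using (Fin; toℕ)
open import Data.Fin.Properties using (toℕ<n)
open import Data.Integer.Base as ℤ using ()
import Data.Integer.Properties as ℤₚ
open import Data.List.Base using (List; []; _∷_; _++_; map; concatMap; upTo; allFin; tabulate; length; replicate; filter)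
import Data.List.Properties as Listₚ
open import Data.List.Relation.Unary.All as All using (All; []; _∷_)
import Data.List.Relation.Unary.All.Properties as Allₚ
open import Data.Nat.Base as ℕ using (ℕ; zero; suc; NonZero; _∸_; _⊓_; _!; _≤_; _<_; z≤n; s≤s)
open import Data.Nat.Combinatorics using (_C_; nCk≡nC[n∸k]; nCn≡1; nCk+nC[k+1]≡[n+1]C[k+1]; k>n⇒nCk≡0)
open import Data.Nat.DivMod using (m/n≤m; m/n*n≤m; m≡m%n+[m/n]*n; m%n<n)
open import Data.Nat.ListAction using (sum; product)
open import Data.Nat.ListAction.Properties using (product-++; sum-++)
import Data.Nat.Properties as ℕₚ
open import Data.Product.Base using (_×_; _,_; proj₁; proj₂)
open import Data.Rational.Base as ℚ using (ℚ; 0ℚ; 1ℚ; _+_; _*_; -_; _-_; _/_; _÷_)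
import Data.Rational.Properties as ℚₚ
open import Data.Rational.Solver using (module +-*-Solver)
import Data.Rational.Unnormalised.Base as ℚᵘ
import Data.Rational.Unnormalised.Properties as ℚᵘₚ
open import Data.Sum.Base using ([_,_]′)
open import Function.Base using (_∘_; id)
open import Relation.Binary.PropositionalEquality hiding ([_])
open import Relation.Nullary using (contradiction)
open import Defs
open +-*-Solver using (solve; _:=_; _:+_; _:*_; _:-_; :-_; con)
open Exp (CommutativeRing.semiring ℚₚ.+-*-commutativeRing) using (_^_; ^-homo-*)

-- Rational arithmetic and finite sums

-- The points a + 1 serve two ends. There the values of H and of the polynomials `choose` are
-- ordinary binomial coefficients, and x is nonzero, so the exponent l(μ) - 1 can be raised to l(μ)
-- by multiplying both sides by x, which is cancelled at the end. Removing a part is a statement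
-- about series. Σ H n qⁿ is the product over m of exp(x q^m / m), and each step of `partitionsUpTo`
-- adds one factor. Marking a part of size m applies t d/dt to one factor, as a series in t = q^m,
-- which only multiplies it by x q^m / m. The hypergeometric sum enters through its parameters: with
-- N = r + s, all of 1 - k, -s, s - N and 1 - N are negatives of naturals, so its terms are products
-- of binomials, and k binom N s k = N Σ_j C(r, j) C(s, j) C(N-1-j, N-k) for 1 ≤ k ≤ N. The same
-- C(N-1-j, N-k) appear when C(N+i-j, N) is expanded by Vandermonde as Σ_k C(i+1, k) C(N-1-j, N-k).

private
  -- Normalised fractions divide by a gcd, which does not reduce on open terms. Over the
  -- unnormalised rationals the facts about `fromℕ` become cross-multiplications of integers, and
  -- this is the bridge.
  toℚᵘ-/ : ∀ i n .{{_ : NonZero n}} → ℚ.toℚᵘ (i / n) ℚᵘ.≃ i ℚᵘ./ n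
  toℚᵘ-/ i (suc n) = ℚₚ.toℚᵘ-fromℚᵘ (ℚᵘ.mkℚᵘ i n)

fromℕ-+ : ∀ m n → fromℕ (m ℕ.+ n) ≡ fromℕ m + fromℕ n
fromℕ-+ m n = ℚₚ.toℚᵘ-injective (begin
  ℚ.toℚᵘ (fromℕ (m ℕ.+ n))                   ≈⟨ toℚᵘ-/ (ℤ.+ (m ℕ.+ n)) 1 ⟩
  ℤ.+ (m ℕ.+ n) ℚᵘ./ 1                          ≈⟨ ℚᵘ.*≡* (cong (ℤ._* ℤ.+ 1) (cong₂ ℤ._+_ (sym (ℤₚ.*-identityʳ (ℤ.+ m))) (sym (ℤₚ.*-identityʳ (ℤ.+ n))))) ⟩
  (ℤ.+ m ℚᵘ./ 1) ℚᵘ.+ (ℤ.+ n ℚᵘ./ 1)              ≈⟨ ℚᵘₚ.+-cong (toℚᵘ-/ (ℤ.+ m) 1) (toℚᵘ-/ (ℤ.+ n) 1) ⟨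
  ℚ.toℚᵘ (fromℕ m) ℚᵘ.+ ℚ.toℚᵘ (fromℕ n)      ≈⟨ ℚₚ.toℚᵘ-homo-+ (fromℕ m) (fromℕ n) ⟨
  ℚ.toℚᵘ (fromℕ m + fromℕ n)                  ∎)
  where open ℚᵘₚ.≃-Reasoning

fromℕ-* : ∀ m n → fromℕ (m ℕ.* n) ≡ fromℕ m * fromℕ n
fromℕ-* m n = ℚₚ.toℚᵘ-injective (begin
  ℚ.toℚᵘ (fromℕ (m ℕ.* n))                   ≈⟨ toℚᵘ-/ (ℤ.+ (m ℕ.* n)) 1 ⟩
  ℤ.+ (m ℕ.* n) ℚᵘ./ 1                          ≈⟨ ℚᵘ.*≡* (cong (ℤ._* ℤ.+ 1) (ℤₚ.pos-* m n)) ⟩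
  (ℤ.+ m ℚᵘ./ 1) ℚᵘ.* (ℤ.+ n ℚᵘ./ 1)              ≈⟨ ℚᵘₚ.*-cong (toℚᵘ-/ (ℤ.+ m) 1) (toℚᵘ-/ (ℤ.+ n) 1) ⟨
  ℚ.toℚᵘ (fromℕ m) ℚᵘ.* ℚ.toℚᵘ (fromℕ n)      ≈⟨ ℚₚ.toℚᵘ-homo-* (fromℕ m) (fromℕ n) ⟨
  ℚ.toℚᵘ (fromℕ m * fromℕ n)                  ∎)
  where open ℚᵘₚ.≃-Reasoning

/-*-fromℕ : ∀ m n .{{_ : NonZero n}} → (ℤ.+ m / n) * fromℕ n ≡ fromℕ m
/-*-fromℕ m n@(suc _) = ℚₚ.toℚᵘ-injective (begin
  ℚ.toℚᵘ ((ℤ.+ m / n) * fromℕ n)                ≈⟨ ℚₚ.toℚᵘ-homo-* (ℤ.+ m / n) (fromℕ n) ⟩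
  ℚ.toℚᵘ (ℤ.+ m / n) ℚᵘ.* ℚ.toℚᵘ (fromℕ n)      ≈⟨ ℚᵘₚ.*-cong (toℚᵘ-/ (ℤ.+ m) n) (toℚᵘ-/ (ℤ.+ n) 1) ⟩
  (ℤ.+ m ℚᵘ./ n) ℚᵘ.* (ℤ.+ n ℚᵘ./ 1)              ≈⟨ ℚᵘ.*≡* (trans (ℤₚ.*-identityʳ (ℤ.+ m ℤ.* ℤ.+ n)) (cong (ℤ.+ m ℤ.*_) (cong ℤ.+_ (sym (ℕₚ.*-identityʳ n))))) ⟩
  ℤ.+ m ℚᵘ./ 1                                  ≈⟨ toℚᵘ-/ (ℤ.+ m) 1 ⟨
  ℚ.toℚᵘ (fromℕ m)                            ∎)
  where open ℚᵘₚ.≃-Reasoning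

fromℕ-suc : ∀ n → fromℕ (suc n) ≡ 1ℚ + fromℕ n
fromℕ-suc = fromℕ-+ 1

fromℕ-nonZero : ∀ n .{{_ : NonZero n}} → ℚ.NonZero (fromℕ n)
fromℕ-nonZero (suc n) = ℚₚ.pos⇒nonZero (fromℕ (suc n)) {{ℚₚ.normalize-pos (suc n) 1}}

*-cancelˡ : ∀ r {p q} .{{_ : ℚ.NonZero r}} → r * p ≡ r * q → p ≡ q
*-cancelˡ r {p} {q} eq = begin
  p                 ≡⟨ undo p ⟨
  ℚ.1/ r * (r * p)  ≡⟨ cong (ℚ.1/ r *_) eq ⟩
  ℚ.1/ r * (r * q)  ≡⟨ undo q ⟩
  q                 ∎
  where
  open ≡-Reasoning
  undo : ∀ t → ℚ.1/ r * (r * t) ≡ t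
  undo t = begin
    ℚ.1/ r * (r * t)  ≡⟨ ℚₚ.*-assoc (ℚ.1/ r) r t ⟨
    ℚ.1/ r * r * t    ≡⟨ cong (_* t) (ℚₚ.*-inverseˡ r) ⟩
    1ℚ * t            ≡⟨ ℚₚ.*-identityˡ t ⟩
    t                 ∎

fromℕ-cancel : ∀ n .{{_ : NonZero n}} {p q} → fromℕ n * p ≡ fromℕ n * q → p ≡ q
fromℕ-cancel n = *-cancelˡ (fromℕ n) {{fromℕ-nonZero n}}

÷-cross : ∀ a p q {b} .{{_ : ℚ.NonZero q}} → a * p ≡ b * q → a * (p ÷ q) ≡ b
÷-cross a p q {b} eq = begin
  a * (p * ℚ.1/ q)  ≡⟨ ℚₚ.*-assoc a p (ℚ.1/ q) ⟨
  a * p * ℚ.1/ q    ≡⟨ cong (_* ℚ.1/ q) eq ⟩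
  b * q * ℚ.1/ q    ≡⟨ ℚₚ.*-assoc b q (ℚ.1/ q) ⟩
  b * (q * ℚ.1/ q)  ≡⟨ cong (b *_) (ℚₚ.*-inverseʳ q) ⟩
  b * 1ℚ            ≡⟨ ℚₚ.*-identityʳ b ⟩
  b                 ∎
  where open ≡-Reasoning

module _ {a} {A : Set a} where

  ∑-cong-All : ∀ {f g : A → ℚ} {xs} → All (λ x → f x ≡ g x) xs → ∑ℚ-syntax xs f ≡ ∑ℚ-syntax xs g
  ∑-cong-All []         = refl
  ∑-cong-All (eq ∷ eqs) = cong₂ _+_ eq (∑-cong-All eqs)

  ∑-cong : ∀ xs {f g : A → ℚ} → (∀ x → f x ≡ g x) → ∑ℚ-syntax xs f ≡ ∑ℚ-syntax xs g
  ∑-cong xs eq = ∑-cong-All (All.universal eq xs)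

  ∑-0 : ∀ xs → ∑ℚ-syntax {A = A} xs (λ _ → 0ℚ) ≡ 0ℚ
  ∑-0 []       = refl
  ∑-0 (x ∷ xs) = trans (ℚₚ.+-identityˡ (∑ℚ-syntax xs (λ _ → 0ℚ))) (∑-0 xs)

  ∑-+ : ∀ xs (f g : A → ℚ) → ∑ℚ-syntax xs (λ x → f x + g x) ≡ ∑ℚ-syntax xs f + ∑ℚ-syntax xs g
  ∑-+ []       f g = refl
  ∑-+ (x ∷ xs) f g = trans (cong (f x + g x +_) (∑-+ xs f g))
    (solve 4 (λ a b c d → (a :+ b) :+ (c :+ d) := (a :+ c) :+ (b :+ d)) refl (f x) (g x) (∑ℚ-syntax xs f) (∑ℚ-syntax xs g))

  ∑-*ˡ : ∀ c xs (f : A → ℚ) → ∑ℚ-syntax xs (λ x → c * f x) ≡ c * ∑ℚ-syntax xs f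
  ∑-*ˡ c []       f = sym (ℚₚ.*-zeroʳ c)
  ∑-*ˡ c (x ∷ xs) f = trans (cong (c * f x +_) (∑-*ˡ c xs f)) (sym (ℚₚ.*-distribˡ-+ c (f x) (∑ℚ-syntax xs f)))

  ∑-++ : ∀ xs ys (f : A → ℚ) → ∑ℚ-syntax (xs ++ ys) f ≡ ∑ℚ-syntax xs f + ∑ℚ-syntax ys f
  ∑-++ []       ys f = sym (ℚₚ.+-identityˡ (∑ℚ-syntax ys f))
  ∑-++ (x ∷ xs) ys f = trans (cong (f x +_) (∑-++ xs ys f)) (sym (ℚₚ.+-assoc (f x) (∑ℚ-syntax xs f) (∑ℚ-syntax ys f)))

module _ {a b} {A : Set a} {B : Set b} where

  ∑-map : ∀ (h : B → A) xs (f : A → ℚ) → ∑ℚ-syntax (map h xs) f ≡ ∑ℚ-syntax xs (f ∘ h)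
  ∑-map h []       f = refl
  ∑-map h (x ∷ xs) f = cong (f (h x) +_) (∑-map h xs f)

  ∑-concatMap : ∀ (h : B → List A) xs (f : A → ℚ) →
                ∑ℚ-syntax (concatMap h xs) f ≡ (∑ℚ[ x ∈ xs ] ∑ℚ-syntax (h x) f)
  ∑-concatMap h []       f = refl
  ∑-concatMap h (x ∷ xs) f = trans (∑-++ (h x) (concatMap h xs) f) (cong (∑ℚ-syntax (h x) f +_) (∑-concatMap h xs f))

  ∑-swap : ∀ xs ys (f : A → B → ℚ) →
           (∑ℚ[ x ∈ xs ] ∑ℚ[ y ∈ ys ] f x y) ≡ (∑ℚ[ y ∈ ys ] ∑ℚ[ x ∈ xs ] f x y)
  ∑-swap []       ys f = sym (∑-0 ys)
  ∑-swap (x ∷ xs) ys f = trans (cong (∑ℚ-syntax ys (f x) +_) (∑-swap xs ys f)) (sym (∑-+ ys (f x) (λ y → ∑ℚ[ z ∈ xs ] f z y)))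

∑-upTo-suc : ∀ n f → ∑ℚ-syntax (upTo (suc n)) f ≡ f 0 + ∑ℚ-syntax (upTo n) (f ∘ suc)
∑-upTo-suc n f = cong (f 0 +_)
  (trans (cong (λ xs → ∑ℚ-syntax xs f) (sym (Listₚ.map-upTo suc n))) (∑-map suc (upTo n) f))

∑-range₁ : ∀ n f → ∑ℚ-syntax (range₁ n) f ≡ ∑ℚ-syntax (upTo n) (f ∘ suc)
∑-range₁ n f = ∑-map suc (upTo n) f

∑-upTo-∷ʳ : ∀ n f → ∑ℚ-syntax (upTo (suc n)) f ≡ ∑ℚ-syntax (upTo n) f + f n
∑-upTo-∷ʳ n f = trans (cong (λ xs → ∑ℚ-syntax xs f) (sym (Listₚ.upTo-∷ʳ n)))
  (trans (∑-++ (upTo n) (n ∷ []) f) (cong (∑ℚ-syntax (upTo n) f +_) (ℚₚ.+-identityʳ (f n))))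

∑-upTo-cong : ∀ n {f g : ℕ → ℚ} → (∀ i → i < n → f i ≡ g i) → ∑ℚ-syntax (upTo n) f ≡ ∑ℚ-syntax (upTo n) g
∑-upTo-cong n eq = ∑-cong-All (Allₚ.applyUpTo⁺₁ id n (eq _))

∑-upTo-extend : ∀ {m n} f → m ≤ n → (∀ i → m ≤ i → f i ≡ 0ℚ) →
                ∑ℚ-syntax (upTo m) f ≡ ∑ℚ-syntax (upTo n) f
∑-upTo-extend {zero}  {n}     f _         vanish =
  sym (trans (∑-cong (upTo n) (λ i → vanish i z≤n)) (∑-0 (upTo n)))
∑-upTo-extend {suc m} {suc n} f (s≤s m≤n) vanish = begin
  ∑ℚ-syntax (upTo (suc m)) f           ≡⟨ ∑-upTo-suc m f ⟩
  f 0 + ∑ℚ-syntax (upTo m) (f ∘ suc)   ≡⟨ cong (f 0 +_) (∑-upTo-extend (f ∘ suc) m≤n (λ i m≤i → vanish (suc i) (s≤s m≤i))) ⟩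
  f 0 + ∑ℚ-syntax (upTo n) (f ∘ suc)   ≡⟨ ∑-upTo-suc n f ⟨
  ∑ℚ-syntax (upTo (suc n)) f           ∎
  where open ≡-Reasoning

∑-upTo-shift : ∀ n f → ∑ℚ-syntax (upTo n) (f ∘ suc) + f 0 ≡ ∑ℚ-syntax (upTo n) f + f n
∑-upTo-shift n f = trans (ℚₚ.+-comm (∑ℚ-syntax (upTo n) (f ∘ suc)) (f 0)) (trans (sym (∑-upTo-suc n f)) (∑-upTo-∷ʳ n f))

∑-allFin : ∀ n (f : ℕ → ℚ) → ∑ℚ-syntax (allFin n) (f ∘ toℕ) ≡ ∑ℚ-syntax (upTo n) f
∑-allFin zero    f = refl
∑-allFin (suc n) f = begin
  f 0 + ∑ℚ-syntax (tabulate {n = n} Fin.suc) (f ∘ toℕ)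
    ≡⟨ cong (λ xs → f 0 + ∑ℚ-syntax xs (f ∘ toℕ)) (sym (Listₚ.map-tabulate {n = n} id Fin.suc)) ⟩
  f 0 + ∑ℚ-syntax (map Fin.suc (allFin n)) (f ∘ toℕ)  ≡⟨ cong (f 0 +_) (∑-map Fin.suc (allFin n) (f ∘ toℕ)) ⟩
  f 0 + ∑ℚ-syntax (allFin n) (f ∘ suc ∘ toℕ)          ≡⟨ cong (f 0 +_) (∑-allFin n (f ∘ suc)) ⟩
  f 0 + ∑ℚ-syntax (upTo n) (f ∘ suc)                  ≡⟨ ∑-upTo-suc n f ⟨
  ∑ℚ-syntax (upTo (suc n)) f                          ∎
  where open ≡-Reasoning

-- Binomial coefficients

bin : ℕ → ℕ → ℚ
bin n k = fromℕ (n C k)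

pascal : ∀ n k → bin (suc n) (suc k) ≡ bin n k + bin n (suc k)
pascal n k = trans (cong fromℕ (sym (nCk+nC[k+1]≡[n+1]C[k+1] n k))) (fromℕ-+ (n C k) (n C suc k))

bin-n-n : ∀ n → bin n n ≡ 1ℚ
bin-n-n n = cong fromℕ (nCn≡1 n)

bin-> : ∀ {n k} → n < k → bin n k ≡ 0ℚ
bin-> n<k = cong fromℕ (k>n⇒nCk≡0 n<k)

bin-sym : ∀ k l → bin (k ℕ.+ l) k ≡ bin (k ℕ.+ l) l
bin-sym k l = cong fromℕ (trans (nCk≡nC[n∸k] (ℕₚ.m≤m+n k l)) (cong ((k ℕ.+ l) C_) (ℕₚ.m+n∸m≡n k l)))

-- The difference is taken in ℚ, not truncated, so the recursion needs no bound on `k`: for n < k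
-- both binomials vanish, and for n = k the factor does.
bin-absorb : ∀ n k → fromℕ (suc k) * bin n (suc k) ≡ (fromℕ n - fromℕ k) * bin n k
bin-absorb zero zero = refl
bin-absorb zero (suc k) = begin
  fromℕ (2 ℕ.+ k) * bin 0 (2 ℕ.+ k)      ≡⟨ cong (fromℕ (2 ℕ.+ k) *_) (bin-> {0} {2 ℕ.+ k} (s≤s z≤n)) ⟩
  fromℕ (2 ℕ.+ k) * 0ℚ                   ≡⟨ ℚₚ.*-zeroʳ (fromℕ (2 ℕ.+ k)) ⟩
  0ℚ                                     ≡⟨ ℚₚ.*-zeroʳ (0ℚ - fromℕ (suc k)) ⟨
  (0ℚ - fromℕ (suc k)) * 0ℚ              ≡⟨ cong ((0ℚ - fromℕ (suc k)) *_) (bin-> {0} {suc k} (s≤s z≤n)) ⟨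
  (0ℚ - fromℕ (suc k)) * bin 0 (suc k)   ∎
  where open ≡-Reasoning
bin-absorb (suc n) zero = begin
  1ℚ * bin (suc n) 1                     ≡⟨ cong (1ℚ *_) (pascal n 0) ⟩
  1ℚ * (1ℚ + bin n 1)                    ≡⟨ ℚₚ.*-distribˡ-+ 1ℚ 1ℚ (bin n 1) ⟩
  1ℚ * 1ℚ + 1ℚ * bin n 1                 ≡⟨ cong (1ℚ * 1ℚ +_) (bin-absorb n zero) ⟩
  1ℚ * 1ℚ + (fromℕ n - 0ℚ) * 1ℚ          ≡⟨ solve 1 (λ n → con 1ℚ :* con 1ℚ :+ (n :- con 0ℚ) :* con 1ℚ := ((con 1ℚ :+ n) :- con 0ℚ) :* con 1ℚ) refl (fromℕ n) ⟩
  ((1ℚ + fromℕ n) - 0ℚ) * 1ℚ             ≡⟨ cong (λ t → (t - 0ℚ) * 1ℚ) (fromℕ-suc n) ⟨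
  (fromℕ (suc n) - 0ℚ) * 1ℚ              ∎
  where open ≡-Reasoning
bin-absorb (suc n) (suc k) = begin
  fromℕ (2 ℕ.+ k) * bin (suc n) (2 ℕ.+ k)
    ≡⟨ cong (fromℕ (2 ℕ.+ k) *_) (pascal n (suc k)) ⟩
  fromℕ (2 ℕ.+ k) * (b + c)
    ≡⟨ ℚₚ.*-distribˡ-+ (fromℕ (2 ℕ.+ k)) b c ⟩
  fromℕ (2 ℕ.+ k) * b + fromℕ (2 ℕ.+ k) * c
    ≡⟨ cong₂ _+_ (cong (_* b) (fromℕ-suc (suc k))) (bin-absorb n (suc k)) ⟩
  (1ℚ + K) * b + (N - K) * b
    ≡⟨ solve 3 (λ N K b → (con 1ℚ :+ K) :* b :+ (N :- K) :* b := K :* b :+ ((con 1ℚ :+ N) :- K) :* b) refl N K b ⟩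
  K * b + ((1ℚ + N) - K) * b
    ≡⟨ cong₂ _+_ (bin-absorb n k) (cong (λ t → ((1ℚ + N) - t) * b) (fromℕ-suc k)) ⟩
  (N - k′) * a + ((1ℚ + N) - (1ℚ + k′)) * b
    ≡⟨ solve 4 (λ N k a b → (N :- k) :* a :+ ((con 1ℚ :+ N) :- (con 1ℚ :+ k)) :* b := ((con 1ℚ :+ N) :- (con 1ℚ :+ k)) :* (a :+ b)) refl N k′ a b ⟩
  ((1ℚ + N) - (1ℚ + k′)) * (a + b)
    ≡⟨ cong₂ _*_ (cong₂ _-_ (fromℕ-suc n) (fromℕ-suc k)) (pascal n k) ⟨
  (fromℕ (suc n) - K) * bin (suc n) (suc k) ∎
  where
  open ≡-Reasoning
  a b c N K k′ : ℚ
  a = bin n k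
  b = bin n (suc k)
  c = bin n (2 ℕ.+ k)
  N = fromℕ n
  K = fromℕ (suc k)
  k′ = fromℕ k

bin-absorb-suc : ∀ n k → fromℕ (suc k) * bin (suc n) (suc k) ≡ fromℕ (suc n) * bin n k
bin-absorb-suc n k = begin
  fromℕ (suc k) * bin (suc n) (suc k)
    ≡⟨ cong (fromℕ (suc k) *_) (pascal n k) ⟩
  fromℕ (suc k) * (bin n k + bin n (suc k))
    ≡⟨ ℚₚ.*-distribˡ-+ (fromℕ (suc k)) (bin n k) (bin n (suc k)) ⟩
  fromℕ (suc k) * bin n k + fromℕ (suc k) * bin n (suc k)
    ≡⟨ cong₂ _+_ (cong (_* bin n k) (fromℕ-suc k)) (bin-absorb n k) ⟩
  (1ℚ + fromℕ k) * bin n k + (fromℕ n - fromℕ k) * bin n k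
    ≡⟨ solve 3 (λ n k a → (con 1ℚ :+ k) :* a :+ (n :- k) :* a := (con 1ℚ :+ n) :* a) refl (fromℕ n) (fromℕ k) (bin n k) ⟩
  (1ℚ + fromℕ n) * bin n k
    ≡⟨ cong (_* bin n k) (fromℕ-suc n) ⟨
  fromℕ (suc n) * bin n k ∎
  where open ≡-Reasoning

bin-! : ∀ k l → fromℕ (k !) * fromℕ (l !) * bin (k ℕ.+ l) k ≡ fromℕ ((k ℕ.+ l) !)
bin-! zero    l = trans (ℚₚ.*-identityʳ (1ℚ * fromℕ (l !))) (ℚₚ.*-identityˡ (fromℕ (l !)))
bin-! (suc k) l = begin
  fromℕ (suc k ℕ.* k !) * L * bin (suc (k ℕ.+ l)) (suc k)
    ≡⟨ cong (λ t → t * L * bin (suc (k ℕ.+ l)) (suc k)) (fromℕ-* (suc k) (k !)) ⟩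
  fromℕ (suc k) * K * L * bin (suc (k ℕ.+ l)) (suc k)
    ≡⟨ solve 4 (λ s K L b → s :* K :* L :* b := K :* L :* (s :* b)) refl (fromℕ (suc k)) K L (bin (suc (k ℕ.+ l)) (suc k)) ⟩
  K * L * (fromℕ (suc k) * bin (suc (k ℕ.+ l)) (suc k))
    ≡⟨ cong (K * L *_) (bin-absorb-suc (k ℕ.+ l) k) ⟩
  K * L * (fromℕ (suc (k ℕ.+ l)) * bin (k ℕ.+ l) k)
    ≡⟨ solve 4 (λ s K L b → K :* L :* (s :* b) := s :* (K :* L :* b)) refl (fromℕ (suc (k ℕ.+ l))) K L (bin (k ℕ.+ l) k) ⟩
  fromℕ (suc (k ℕ.+ l)) * (K * L * bin (k ℕ.+ l) k)
    ≡⟨ cong (fromℕ (suc (k ℕ.+ l)) *_) (bin-! k l) ⟩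
  fromℕ (suc (k ℕ.+ l)) * fromℕ ((k ℕ.+ l) !)
    ≡⟨ fromℕ-* (suc (k ℕ.+ l)) ((k ℕ.+ l) !) ⟨
  fromℕ (suc (k ℕ.+ l) !) ∎
  where
  open ≡-Reasoning
  K L : ℚ
  K = fromℕ (k !)
  L = fromℕ (l !)

!-cancel : ∀ n {p q} → fromℕ (n !) * p ≡ fromℕ (n !) * q → p ≡ q
!-cancel n = fromℕ-cancel (n !) {{n ℕₚ.!≢0}}

-- Both sides are the multinomial coefficient (a+b+c)! / (a! b! c!). Multiplying by the three
-- factorials keeps division out of the argument.
trinomial-revision : ∀ a b c → bin (a ℕ.+ (b ℕ.+ c)) (a ℕ.+ b) * bin (a ℕ.+ b) a
                             ≡ bin (a ℕ.+ (b ℕ.+ c)) a * bin (b ℕ.+ c) c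
trinomial-revision a b c = !-cancel a (!-cancel b (!-cancel c (begin
  D * (B * (A * (P * Q)))                ≡⟨ solve 5 (λ A B D P Q → D :* (B :* (A :* (P :* Q))) := (A :* B :* Q) :* D :* P) refl A B D P Q ⟩
  (A * B * Q) * D * P                    ≡⟨ cong (λ t → t * D * P) (bin-! a b) ⟩
  fromℕ ((a ℕ.+ b) !) * D * P            ≡⟨ cong (λ t → fromℕ ((a ℕ.+ b) !) * D * bin t (a ℕ.+ b)) (ℕₚ.+-assoc a b c) ⟨
  fromℕ ((a ℕ.+ b) !) * D * bin (a ℕ.+ b ℕ.+ c) (a ℕ.+ b)
                                         ≡⟨ bin-! (a ℕ.+ b) c ⟩
  fromℕ ((a ℕ.+ b ℕ.+ c) !)              ≡⟨ cong (λ t → fromℕ (t !)) (ℕₚ.+-assoc a b c) ⟩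
  fromℕ ((a ℕ.+ (b ℕ.+ c)) !)            ≡⟨ bin-! a (b ℕ.+ c) ⟨
  A * fromℕ ((b ℕ.+ c) !) * R            ≡⟨ cong (λ t → A * t * R) (bin-! b c) ⟨
  A * (B * D * bin (b ℕ.+ c) b) * R      ≡⟨ cong (λ t → A * (B * D * t) * R) (bin-sym b c) ⟩
  A * (B * D * S) * R                    ≡⟨ solve 5 (λ A B D R S → A :* (B :* D :* S) :* R := D :* (B :* (A :* (R :* S)))) refl A B D R S ⟩
  D * (B * (A * (R * S)))                ∎)))
  where
  open ≡-Reasoning
  A B D P Q R S : ℚ
  A = fromℕ (a !)
  B = fromℕ (b !)
  D = fromℕ (c !)
  P = bin (a ℕ.+ (b ℕ.+ c)) (a ℕ.+ b)
  Q = bin (a ℕ.+ b) a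
  R = bin (a ℕ.+ (b ℕ.+ c)) a
  S = bin (b ℕ.+ c) c

-- Rising factorials as binomial coefficients

sgn : ℕ → ℚ
sgn zero    = 1ℚ
sgn (suc j) = - sgn j

sgn² : ∀ j → sgn j * sgn j ≡ 1ℚ
sgn² zero    = refl
sgn² (suc j) = trans (solve 1 (λ s → (:- s) :* (:- s) := s :* s) refl (sgn j)) (sgn² j)

-- The new factor -b + j is the negative of the factor b - j in `bin-absorb`. This serves the
-- parameters 1 - k, -s, s - N and 1 - N of the hypergeometric sum.
rising-neg : ∀ b j → rising (- fromℕ b) j ≡ sgn j * (fromℕ (j !) * bin b j)
rising-neg b zero    = refl
rising-neg b (suc j) = begin
  rising (- B) j * (- B + K)               ≡⟨ cong (_* (- B + K)) (rising-neg b j) ⟩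
  sgn j * (F * bin b j) * (- B + K)        ≡⟨ solve 5 (λ B K s F a → s :* (F :* a) :* ((:- B) :+ K) := (:- s) :* (F :* ((B :- K) :* a))) refl B K (sgn j) F (bin b j) ⟩
  - sgn j * (F * ((B - K) * bin b j))      ≡⟨ cong (λ t → - sgn j * (F * t)) (bin-absorb b j) ⟨
  - sgn j * (F * (fromℕ (suc j) * bin b (suc j)))
                                           ≡⟨ solve 4 (λ s F t a → (:- s) :* (F :* (t :* a)) := (:- s) :* ((t :* F) :* a)) refl (sgn j) F (fromℕ (suc j)) (bin b (suc j)) ⟩
  - sgn j * (fromℕ (suc j) * F * bin b (suc j))
                                           ≡⟨ cong (λ t → - sgn j * (t * bin b (suc j))) (fromℕ-* (suc j) (j !)) ⟨
  - sgn j * (fromℕ (suc j !) * bin b (suc j)) ∎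
  where
  open ≡-Reasoning
  B K F : ℚ
  B = fromℕ b
  K = fromℕ j
  F = fromℕ (j !)

rising-suc : ∀ i r → rising (fromℕ (suc i)) r ≡ fromℕ (r !) * bin (r ℕ.+ i) r
rising-suc i zero    = refl
rising-suc i (suc r) = begin
  rising (fromℕ (suc i)) r * (fromℕ (suc i) + fromℕ r)
    ≡⟨ cong₂ _*_ (rising-suc i r) (trans (sym (fromℕ-+ (suc i) r)) (cong (fromℕ ∘ suc) (ℕₚ.+-comm i r))) ⟩
  F * bin (r ℕ.+ i) r * fromℕ (suc (r ℕ.+ i))
    ≡⟨ solve 3 (λ F b t → F :* b :* t := F :* (t :* b)) refl F (bin (r ℕ.+ i) r) (fromℕ (suc (r ℕ.+ i))) ⟩
  F * (fromℕ (suc (r ℕ.+ i)) * bin (r ℕ.+ i) r)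
    ≡⟨ cong (F *_) (bin-absorb-suc (r ℕ.+ i) r) ⟨
  F * (fromℕ (suc r) * bin (suc (r ℕ.+ i)) (suc r))
    ≡⟨ solve 3 (λ F t b → F :* (t :* b) := (t :* F) :* b) refl F (fromℕ (suc r)) (bin (suc (r ℕ.+ i)) (suc r)) ⟩
  fromℕ (suc r) * F * bin (suc (r ℕ.+ i)) (suc r)
    ≡⟨ cong (_* bin (suc (r ℕ.+ i)) (suc r)) (fromℕ-* (suc r) (r !)) ⟨
  fromℕ (suc r !) * bin (suc (r ℕ.+ i)) (suc r) ∎
  where
  open ≡-Reasoning
  F : ℚ
  F = fromℕ (r !)

-- Convolutions

conv : (ℕ → ℚ) → (ℕ → ℚ) → ℕ → ℚ
conv f g n = ∑ℚ[ i ∈ upTo (suc n) ] f i * g (n ∸ i)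

conv-suc : ∀ f g n → conv f g (suc n) ≡ f 0 * g (suc n) + conv (f ∘ suc) g n
conv-suc f g n = ∑-upTo-suc (suc n) (λ i → f i * g (suc n ∸ i))

conv-congʳ : ∀ f {g g′} n → (∀ i → i ≤ n → g i ≡ g′ i) → conv f g n ≡ conv f g′ n
conv-congʳ f n eq = ∑-cong (upTo (suc n)) (λ i → cong (f i *_) (eq (n ∸ i) (ℕₚ.m∸n≤m n i)))

conv-+ˡ : ∀ {f} f₁ f₂ g n → (∀ i → f i ≡ f₁ i + f₂ i) → conv f g n ≡ conv f₁ g n + conv f₂ g n
conv-+ˡ f₁ f₂ g n eq = trans
  (∑-cong (upTo (suc n)) (λ i → trans (cong (_* g (n ∸ i)) (eq i)) (ℚₚ.*-distribʳ-+ (g (n ∸ i)) (f₁ i) (f₂ i))))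
  (∑-+ (upTo (suc n)) (λ i → f₁ i * g (n ∸ i)) (λ i → f₂ i * g (n ∸ i)))

conv-0ˡ : ∀ {f} g n → (∀ i → f i ≡ 0ℚ) → conv f g n ≡ 0ℚ
conv-0ˡ g n eq = trans
  (∑-cong (upTo (suc n)) (λ i → trans (cong (_* g (n ∸ i)) (eq i)) (ℚₚ.*-zeroˡ (g (n ∸ i)))))
  (∑-0 (upTo (suc n)))

-- In terms of series this is q^K / (1-q)^(K+1) times 1 / (1-q)^(a+1), equal to q^K / (1-q)^(K+a+2).
-- The case K = 0 sums H, and general K gives the right side of the theorem.
parallel-vandermonde : ∀ K a n → conv (λ i → bin i K) (λ p → bin (p ℕ.+ a) a) n ≡ bin (suc (n ℕ.+ a)) (suc (K ℕ.+ a))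
parallel-vandermonde zero a zero = begin
  1ℚ * bin a a + 0ℚ   ≡⟨ trans (ℚₚ.+-identityʳ (1ℚ * bin a a)) (ℚₚ.*-identityˡ (bin a a)) ⟩
  bin a a             ≡⟨ trans (bin-n-n a) (sym (bin-n-n (suc a))) ⟩
  bin (suc a) (suc a) ∎
  where open ≡-Reasoning
parallel-vandermonde zero a (suc n) = begin
  conv (λ i → bin i 0) g (suc n)                       ≡⟨ conv-suc (λ i → bin i 0) g n ⟩
  1ℚ * g (suc n) + conv (λ i → bin i 0) g n            ≡⟨ cong₂ _+_ (ℚₚ.*-identityˡ (g (suc n))) (parallel-vandermonde zero a n) ⟩
  bin (suc n ℕ.+ a) a + bin (suc n ℕ.+ a) (suc a)      ≡⟨ pascal (suc n ℕ.+ a) a ⟨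
  bin (suc (suc n ℕ.+ a)) (suc a)                      ∎
  where
  open ≡-Reasoning
  g : ℕ → ℚ
  g p = bin (p ℕ.+ a) a
parallel-vandermonde (suc K) a zero = begin
  bin 0 (suc K) * bin a a + 0ℚ     ≡⟨ ℚₚ.+-identityʳ (bin 0 (suc K) * bin a a) ⟩
  bin 0 (suc K) * bin a a          ≡⟨ cong (_* bin a a) (bin-> {0} {suc K} (s≤s z≤n)) ⟩
  0ℚ * bin a a                     ≡⟨ ℚₚ.*-zeroˡ (bin a a) ⟩
  0ℚ                               ≡⟨ bin-> {suc a} {suc (suc K ℕ.+ a)} (s≤s (s≤s (ℕₚ.m≤n+m a K))) ⟨
  bin (suc a) (suc (suc K ℕ.+ a))  ∎
  where open ≡-Reasoning
parallel-vandermonde (suc K) a (suc n) = begin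
  conv (λ i → bin i (suc K)) g (suc n)
    ≡⟨ conv-suc (λ i → bin i (suc K)) g n ⟩
  bin 0 (suc K) * g (suc n) + conv (λ i → bin (suc i) (suc K)) g n
    ≡⟨ cong₂ _+_ (trans (cong (_* g (suc n)) (bin-> {0} {suc K} (s≤s z≤n))) (ℚₚ.*-zeroˡ (g (suc n))))
                 (conv-+ˡ (λ i → bin i K) (λ i → bin i (suc K)) g n (λ i → pascal i K)) ⟩
  0ℚ + (conv (λ i → bin i K) g n + conv (λ i → bin i (suc K)) g n)
    ≡⟨ ℚₚ.+-identityˡ (conv (λ i → bin i K) g n + conv (λ i → bin i (suc K)) g n) ⟩
  conv (λ i → bin i K) g n + conv (λ i → bin i (suc K)) g n
    ≡⟨ cong₂ _+_ (parallel-vandermonde K a n) (parallel-vandermonde (suc K) a n) ⟩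
  bin (suc (n ℕ.+ a)) (suc (K ℕ.+ a)) + bin (suc (n ℕ.+ a)) (suc (suc K ℕ.+ a))
    ≡⟨ pascal (suc (n ℕ.+ a)) (suc (K ℕ.+ a)) ⟨
  bin (suc (suc n ℕ.+ a)) (suc (suc K ℕ.+ a)) ∎
  where
  open ≡-Reasoning
  g : ℕ → ℚ
  g p = bin (p ℕ.+ a) a

vandermonde : ∀ m M n → conv (bin m) (bin M) n ≡ bin (m ℕ.+ M) n
vandermonde zero M zero    = refl
vandermonde zero M (suc n) = begin
  conv (bin 0) (bin M) (suc n)                          ≡⟨ conv-suc (bin 0) (bin M) n ⟩
  1ℚ * bin M (suc n) + conv (bin 0 ∘ suc) (bin M) n     ≡⟨ cong₂ _+_ (ℚₚ.*-identityˡ (bin M (suc n))) (conv-0ˡ (bin M) n (λ i → bin-> {0} {suc i} (s≤s z≤n))) ⟩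
  bin M (suc n) + 0ℚ                                    ≡⟨ ℚₚ.+-identityʳ (bin M (suc n)) ⟩
  bin M (suc n)                                         ∎
  where open ≡-Reasoning
vandermonde (suc m) M zero    = refl
vandermonde (suc m) M (suc n) = begin
  conv (bin (suc m)) (bin M) (suc n)
    ≡⟨ conv-suc (bin (suc m)) (bin M) n ⟩
  d + conv (bin (suc m) ∘ suc) (bin M) n
    ≡⟨ cong (d +_) (conv-+ˡ (bin m) (bin m ∘ suc) (bin M) n (pascal m)) ⟩
  d + (conv (bin m) (bin M) n + conv (bin m ∘ suc) (bin M) n)
    ≡⟨ solve 3 (λ a b c → a :+ (b :+ c) := b :+ (a :+ c)) refl d (conv (bin m) (bin M) n) (conv (bin m ∘ suc) (bin M) n) ⟩
  conv (bin m) (bin M) n + (d + conv (bin m ∘ suc) (bin M) n)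
    ≡⟨ cong (conv (bin m) (bin M) n +_) (conv-suc (bin m) (bin M) n) ⟨
  conv (bin m) (bin M) n + conv (bin m) (bin M) (suc n)
    ≡⟨ cong₂ _+_ (vandermonde m M n) (vandermonde m M (suc n)) ⟩
  bin (m ℕ.+ M) n + bin (m ℕ.+ M) (suc n)
    ≡⟨ pascal (m ℕ.+ M) n ⟨
  bin (suc m ℕ.+ M) (suc n) ∎
  where
  open ≡-Reasoning
  d : ℚ
  d = 1ℚ * bin M (suc n)

-- A product of two binomial coefficients as a single sum

module _ (r s i : ℕ) where

  private
    N : ℕ
    N = r ℕ.+ s

    R′ : ℚ
    R′ = fromℕ (suc r)

    -- w (j + 1) is the part of the j-th summand that split moves to the index
    -- j + 1; since w 0 = w (s + 1) = 0, its sum may be taken over w j instead.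
    b w : ℕ → ℚ
    b j = bin (suc N ℕ.+ i ∸ j) (suc N)
    w j = bin s j * (R′ * bin (suc r) j - (R′ + fromℕ j) * bin r j) * b j

    w-0 : w 0 ≡ 0ℚ
    w-0 = solve 2 (λ R b → con 1ℚ :* (R :* con 1ℚ :- (R :+ con 0ℚ) :* con 1ℚ) :* b := con 0ℚ) refl R′ (b 0)

    w-end : w (suc s) ≡ 0ℚ
    w-end = trans (cong (λ t → t * d * b (suc s)) (bin-> (ℕₚ.n<1+n s)))
                  (solve 2 (λ d b → con 0ℚ :* d :* b := con 0ℚ) refl d (b (suc s)))
      where
      d : ℚ
      d = R′ * bin (suc r) (suc s) - (R′ + fromℕ (suc s)) * bin r (suc s)

    -- The bracket in `w` is chosen for `collect`: it supplies what `v j` lacks to carry the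
    -- coefficient C(r+1, j). Pascal and absorption turn the bracket at `suc j` into (1 + j) C(r,
    -- j), and a second absorption in s yields the factor s - j that `split` produces.
    w-suc : ∀ j → w (suc j) ≡ (fromℕ s - fromℕ j) * (bin r j * bin s j) * b (suc j)
    w-suc j = cong (_* b (suc j)) (begin
      S′ * (R′ * bin (suc r) (suc j) - (R′ + fromℕ (suc j)) * r₁)
        ≡⟨ cong (λ t → S′ * (R′ * t - (R′ + fromℕ (suc j)) * r₁)) (pascal r j) ⟩
      S′ * (R′ * (r₀ + r₁) - (R′ + fromℕ (suc j)) * r₁)
        ≡⟨ solve 5 (λ S R a c J → S :* (R :* (a :+ c) :- (R :+ J) :* c) := S :* (R :* a :- J :* c)) refl S′ R′ r₀ r₁ (fromℕ (suc j)) ⟩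
      S′ * (R′ * r₀ - fromℕ (suc j) * r₁)
        ≡⟨ cong₂ (λ t u → S′ * (t * r₀ - u)) (fromℕ-suc r) (bin-absorb r j) ⟩
      S′ * ((1ℚ + fromℕ r) * r₀ - (fromℕ r - fromℕ j) * r₀)
        ≡⟨ solve 4 (λ S r a j → S :* ((con 1ℚ :+ r) :* a :- (r :- j) :* a) := ((con 1ℚ :+ j) :* S) :* a) refl S′ (fromℕ r) r₀ (fromℕ j) ⟩
      ((1ℚ + fromℕ j) * S′) * r₀
        ≡⟨ cong (_* r₀) (trans (cong (_* S′) (sym (fromℕ-suc j))) (bin-absorb s j)) ⟩
      ((fromℕ s - fromℕ j) * bin s j) * r₀
        ≡⟨ solve 3 (λ d a c → d :* c :* a := d :* (a :* c)) refl (fromℕ s - fromℕ j) r₀ (bin s j) ⟩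
      (fromℕ s - fromℕ j) * (r₀ * bin s j) ∎)
      where
      open ≡-Reasoning
      S′ r₀ r₁ : ℚ
      S′ = bin s (suc j)
      r₀ = bin r j
      r₁ = bin r (suc j)

    -- After multiplication by N + 1 both binomials on the right become multiples of C(y, N) with y
    -- = N + i - j, with factors y + 1 and y - N. What remains is a polynomial identity in r, s, i
    -- and j. The bound on `j` makes y a true difference.
    split : ∀ j → j ≤ s → fromℕ (suc (r ℕ.+ i)) * bin (N ℕ.+ i ∸ j) N
                        ≡ (R′ + fromℕ j) * b j + (fromℕ s - fromℕ j) * b (suc j)
    split j j≤s = fromℕ-cancel (suc N) (begin
      M * (fromℕ (suc (r ℕ.+ i)) * B)
        ≡⟨ cong₂ (λ t u → t * (u * B)) M≡ (trans (fromℕ-suc (r ℕ.+ i)) (cong (1ℚ +_) (fromℕ-+ r i))) ⟩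
      (1ℚ + (fr + fs)) * ((1ℚ + (fr + fi)) * B)
        ≡⟨ solve 5 (λ r s i j B → (con 1ℚ :+ (r :+ s)) :* ((con 1ℚ :+ (r :+ i)) :* B)
                      := (con 1ℚ :+ r :+ j) :* ((con 1ℚ :+ (r :+ s :+ i :- j)) :* B) :+ (s :- j) :* ((r :+ s :+ i :- j :- (r :+ s)) :* B))
             refl fr fs fi fj B ⟩
      (1ℚ + fr + fj) * ((1ℚ + (fr + fs + fi - fj)) * B) + (fs - fj) * ((fr + fs + fi - fj - (fr + fs)) * B)
        ≡⟨ cong₂ _+_ (cong₂ (λ t u → (t + fj) * (u * B)) (sym (fromℕ-suc r)) (trans (cong (1ℚ +_) (sym y≡)) (sym (fromℕ-suc y))))
                     (cong₂ (λ t u → (fs - fj) * ((t - u) * B)) (sym y≡) (sym (fromℕ-+ r s))) ⟩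
      (R′ + fj) * (fromℕ (suc y) * B) + (fs - fj) * ((fromℕ y - fromℕ N) * B)
        ≡⟨ cong₂ (λ t u → (R′ + fj) * t + (fs - fj) * u) (bin-absorb-suc y N) (bin-absorb y N) ⟨
      (R′ + fj) * (M * bin (suc y) (suc N)) + (fs - fj) * (M * b (suc j))
        ≡⟨ cong (λ t → (R′ + fj) * (M * bin t (suc N)) + (fs - fj) * (M * b (suc j))) (sym (ℕₚ.+-∸-assoc 1 j≤N+i)) ⟩
      (R′ + fj) * (M * b j) + (fs - fj) * (M * b (suc j))
        ≡⟨ solve 5 (λ M x y c d → x :* (M :* c) :+ y :* (M :* d) := M :* (x :* c :+ y :* d)) refl M (R′ + fj) (fs - fj) (b j) (b (suc j)) ⟩
      M * ((R′ + fj) * b j + (fs - fj) * b (suc j)) ∎)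
      where
      open ≡-Reasoning
      y : ℕ
      y = N ℕ.+ i ∸ j
      M B fr fs fi fj : ℚ
      M  = fromℕ (suc N)
      B  = bin y N
      fr = fromℕ r
      fs = fromℕ s
      fi = fromℕ i
      fj = fromℕ j
      M≡ : M ≡ 1ℚ + (fr + fs)
      M≡ = trans (fromℕ-suc N) (cong (1ℚ +_) (fromℕ-+ r s))
      j≤N+i : j ≤ N ℕ.+ i
      j≤N+i = ℕₚ.≤-trans j≤s (ℕₚ.≤-trans (ℕₚ.m≤n+m s r) (ℕₚ.m≤m+n N i))
      y≡ : fromℕ y ≡ fr + fs + fi - fj
      y≡ = begin
        fromℕ y                     ≡⟨ solve 2 (λ y j → y := y :+ j :- j) refl (fromℕ y) fj ⟩
        fromℕ y + fj - fj           ≡⟨ cong (_- fj) (fromℕ-+ y j) ⟨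
        fromℕ (y ℕ.+ j) - fj        ≡⟨ cong (λ t → fromℕ t - fj) (ℕₚ.m∸n+n≡m j≤N+i) ⟩
        fromℕ (N ℕ.+ i) - fj        ≡⟨ cong (_- fj) (trans (fromℕ-+ N i) (cong (_+ fi) (fromℕ-+ r s))) ⟩
        fr + fs + fi - fj           ∎

  -- Since C(r+1+i, r+1) is (r+1+i)/(r+1) times C(r+i, r), the sum must have the same ratio for the
  -- induction on r. It does after an exchange between neighbouring summands, in the manner of Abel
  -- summation.
  li-shanlan-step : fromℕ (suc (r ℕ.+ i)) * (∑ℚ[ j ∈ upTo (suc s) ] bin r j * bin s j * bin (r ℕ.+ s ℕ.+ i ∸ j) (r ℕ.+ s))
               ≡ fromℕ (suc r) * (∑ℚ[ j ∈ upTo (suc s) ] bin (suc r) j * bin s j * bin (suc r ℕ.+ s ℕ.+ i ∸ j) (suc r ℕ.+ s))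
  li-shanlan-step = begin
    c * (∑ℚ[ j ∈ upTo (suc s) ] bin r j * bin s j * bin (N ℕ.+ i ∸ j) N)
      ≡⟨ ∑-*ˡ c (upTo (suc s)) (λ j → bin r j * bin s j * bin (N ℕ.+ i ∸ j) N) ⟨
    (∑ℚ[ j ∈ upTo (suc s) ] c * (bin r j * bin s j * bin (N ℕ.+ i ∸ j) N))
      ≡⟨ ∑-upTo-cong (suc s) (λ j j<1+s → term j (ℕ.s≤s⁻¹ j<1+s)) ⟩
    (∑ℚ[ j ∈ upTo (suc s) ] v j + w (suc j))
      ≡⟨ ∑-+ (upTo (suc s)) v (w ∘ suc) ⟩
    ∑ℚ-syntax (upTo (suc s)) v + ∑ℚ-syntax (upTo (suc s)) (w ∘ suc)
      ≡⟨ cong (∑ℚ-syntax (upTo (suc s)) v +_) shift ⟩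
    ∑ℚ-syntax (upTo (suc s)) v + ∑ℚ-syntax (upTo (suc s)) w
      ≡⟨ ∑-+ (upTo (suc s)) v w ⟨
    (∑ℚ[ j ∈ upTo (suc s) ] v j + w j)
      ≡⟨ ∑-cong (upTo (suc s)) collect ⟩
    (∑ℚ[ j ∈ upTo (suc s) ] R′ * (bin (suc r) j * bin s j * b j))
      ≡⟨ ∑-*ˡ R′ (upTo (suc s)) (λ j → bin (suc r) j * bin s j * b j) ⟩
    R′ * (∑ℚ[ j ∈ upTo (suc s) ] bin (suc r) j * bin s j * b j) ∎
    where
    open ≡-Reasoning
    c : ℚ
    c = fromℕ (suc (r ℕ.+ i))
    v : ℕ → ℚ
    v j = (R′ + fromℕ j) * (bin r j * bin s j) * b j
    term : ∀ j → j ≤ s → c * (bin r j * bin s j * bin (N ℕ.+ i ∸ j) N) ≡ v j + w (suc j)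
    term j j≤s = begin
      c * (a * bin (N ℕ.+ i ∸ j) N)        ≡⟨ solve 3 (λ c a B → c :* (a :* B) := a :* (c :* B)) refl c a (bin (N ℕ.+ i ∸ j) N) ⟩
      a * (c * bin (N ℕ.+ i ∸ j) N)        ≡⟨ cong (a *_) (split j j≤s) ⟩
      a * ((R′ + fromℕ j) * b j + (fromℕ s - fromℕ j) * b (suc j))
                                           ≡⟨ solve 5 (λ a x p y q → a :* (x :* p :+ y :* q) := x :* a :* p :+ y :* a :* q) refl a (R′ + fromℕ j) (b j) (fromℕ s - fromℕ j) (b (suc j)) ⟩
      v j + (fromℕ s - fromℕ j) * a * b (suc j)
                                           ≡⟨ cong (v j +_) (w-suc j) ⟨
      v j + w (suc j)                      ∎
      where
      a : ℚ
      a = bin r j * bin s j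
    shift : ∑ℚ-syntax (upTo (suc s)) (w ∘ suc) ≡ ∑ℚ-syntax (upTo (suc s)) w
    shift = begin
      ∑ℚ-syntax (upTo (suc s)) (w ∘ suc)        ≡⟨ ℚₚ.+-identityʳ (∑ℚ-syntax (upTo (suc s)) (w ∘ suc)) ⟨
      ∑ℚ-syntax (upTo (suc s)) (w ∘ suc) + 0ℚ   ≡⟨ cong (∑ℚ-syntax (upTo (suc s)) (w ∘ suc) +_) w-0 ⟨
      ∑ℚ-syntax (upTo (suc s)) (w ∘ suc) + w 0  ≡⟨ ∑-upTo-shift (suc s) w ⟩
      ∑ℚ-syntax (upTo (suc s)) w + w (suc s)    ≡⟨ cong (∑ℚ-syntax (upTo (suc s)) w +_) w-end ⟩
      ∑ℚ-syntax (upTo (suc s)) w + 0ℚ           ≡⟨ ℚₚ.+-identityʳ (∑ℚ-syntax (upTo (suc s)) w) ⟩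
      ∑ℚ-syntax (upTo (suc s)) w                ∎
    collect : ∀ j → v j + w j ≡ R′ * (bin (suc r) j * bin s j * b j)
    collect j = solve 6 (λ R j r₀ r₁ s b → (R :+ j) :* (r₀ :* s) :* b :+ s :* (R :* r₁ :- (R :+ j) :* r₀) :* b := R :* (r₁ :* s :* b))
                  refl R′ (fromℕ j) (bin r j) (bin (suc r) j) (bin s j) (b j)

-- Li Shanlan's identity is the case r = s.
li-shanlan : ∀ r s i → bin (r ℕ.+ i) r * bin (s ℕ.+ i) s
                  ≡ (∑ℚ[ j ∈ upTo (suc s) ] bin r j * bin s j * bin (r ℕ.+ s ℕ.+ i ∸ j) (r ℕ.+ s))
li-shanlan zero s i = sym (begin
  (∑ℚ[ j ∈ upTo (suc s) ] bin 0 j * bin s j * bin (s ℕ.+ i ∸ j) s)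
    ≡⟨ ∑-upTo-suc s (λ j → bin 0 j * bin s j * bin (s ℕ.+ i ∸ j) s) ⟩
  1ℚ * B + (∑ℚ[ j ∈ upTo s ] bin 0 (suc j) * bin s (suc j) * bin (s ℕ.+ i ∸ suc j) s)
    ≡⟨ cong (1ℚ * B +_) (trans (∑-cong (upTo s) vanish) (∑-0 (upTo s))) ⟩
  1ℚ * B + 0ℚ
    ≡⟨ ℚₚ.+-identityʳ (1ℚ * B) ⟩
  1ℚ * B ∎)
  where
  open ≡-Reasoning
  B : ℚ
  B = bin (s ℕ.+ i) s
  vanish : ∀ j → bin 0 (suc j) * bin s (suc j) * bin (s ℕ.+ i ∸ suc j) s ≡ 0ℚ
  vanish j = trans (cong (λ t → t * bin s (suc j) * bin (s ℕ.+ i ∸ suc j) s) (bin-> {0} {suc j} (s≤s z≤n)))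
                   (solve 2 (λ x y → con 0ℚ :* x :* y := con 0ℚ) refl (bin s (suc j)) (bin (s ℕ.+ i ∸ suc j) s))
li-shanlan (suc r) s i = fromℕ-cancel (suc r) (begin
  R′ * (bin (suc (r ℕ.+ i)) (suc r) * Q)       ≡⟨ ℚₚ.*-assoc R′ (bin (suc (r ℕ.+ i)) (suc r)) Q ⟨
  R′ * bin (suc (r ℕ.+ i)) (suc r) * Q         ≡⟨ cong (_* Q) (bin-absorb-suc (r ℕ.+ i) r) ⟩
  fromℕ (suc (r ℕ.+ i)) * bin (r ℕ.+ i) r * Q  ≡⟨ ℚₚ.*-assoc (fromℕ (suc (r ℕ.+ i))) (bin (r ℕ.+ i) r) Q ⟩
  fromℕ (suc (r ℕ.+ i)) * (bin (r ℕ.+ i) r * Q)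
    ≡⟨ cong (fromℕ (suc (r ℕ.+ i)) *_) (li-shanlan r s i) ⟩
  fromℕ (suc (r ℕ.+ i)) * (∑ℚ[ j ∈ upTo (suc s) ] bin r j * bin s j * bin (r ℕ.+ s ℕ.+ i ∸ j) (r ℕ.+ s))
    ≡⟨ li-shanlan-step r s i ⟩
  R′ * (∑ℚ[ j ∈ upTo (suc s) ] bin (suc r) j * bin s j * bin (suc r ℕ.+ s ℕ.+ i ∸ j) (suc r ℕ.+ s)) ∎)
  where
  open ≡-Reasoning
  R′ Q : ℚ
  R′ = fromℕ (suc r)
  Q  = bin (s ℕ.+ i) s

-- The weights binom

-- The lower index is N ∸ K rather than K ∸ j: for K < j the latter would truncate to 0 and make the
-- right side nonzero, while here N ∸ j < N ∸ K and both sides vanish. It is also the index that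
-- Vandermonde produces.
complement-revision : ∀ {N K j} → K ≤ N → j ≤ N → bin N K * bin K j ≡ bin N j * bin (N ∸ j) (N ∸ K)
complement-revision {N} {K} {j} K≤N j≤N = [ inside , outside ]′ (ℕₚ.≤-<-connex j K)
  where
  open ≡-Reasoning

  inside : j ≤ K → bin N K * bin K j ≡ bin N j * bin (N ∸ j) (N ∸ K)
  inside j≤K = begin
    bin N K * bin K j
      ≡⟨ cong₂ (λ n k → bin n k * bin k j) N≡ K≡ ⟨
    bin (j ℕ.+ (b ℕ.+ c)) (j ℕ.+ b) * bin (j ℕ.+ b) j
      ≡⟨ trinomial-revision j b c ⟩
    bin (j ℕ.+ (b ℕ.+ c)) j * bin (b ℕ.+ c) c
      ≡⟨ cong₂ (λ n m → bin n j * bin m c) N≡ (trans (sym (ℕₚ.m+n∸m≡n j (b ℕ.+ c))) (cong (_∸ j) N≡)) ⟩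
    bin N j * bin (N ∸ j) (N ∸ K) ∎
    where
    b c : ℕ
    b = K ∸ j
    c = N ∸ K
    K≡ : j ℕ.+ b ≡ K
    K≡ = ℕₚ.m+[n∸m]≡n j≤K
    N≡ : j ℕ.+ (b ℕ.+ c) ≡ N
    N≡ = trans (sym (ℕₚ.+-assoc j b c)) (trans (cong (ℕ._+ c) K≡) (ℕₚ.m+[n∸m]≡n K≤N))

  outside : K < j → bin N K * bin K j ≡ bin N j * bin (N ∸ j) (N ∸ K)
  outside K<j = begin
    bin N K * bin K j               ≡⟨ cong (bin N K *_) (bin-> K<j) ⟩
    bin N K * 0ℚ                    ≡⟨ ℚₚ.*-zeroʳ (bin N K) ⟩
    0ℚ                              ≡⟨ ℚₚ.*-zeroʳ (bin N j) ⟨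
    bin N j * 0ℚ                    ≡⟨ cong (bin N j *_) (bin-> (ℕₚ.∸-monoʳ-< K<j j≤N)) ⟨
    bin N j * bin (N ∸ j) (N ∸ K)   ∎

-- The summand of `binom` is local to its definition and cannot be named from outside. With `f`
-- implicit, unification finds it, and the equation for `c * f i` clears its denominator.
∑-allFin-cross : ∀ {n k x c} {f : Fin n → ℚ} g → k * x ≡ c → (∀ i → c * f i ≡ g (toℕ i)) →
                 k * (x * ∑ℚ-syntax (allFin n) f) ≡ ∑ℚ-syntax (upTo n) g
∑-allFin-cross {n} {k} {x} {c} {f} g kx≡c eq = begin
  k * (x * ∑ℚ-syntax (allFin n) f)       ≡⟨ ℚₚ.*-assoc k x (∑ℚ-syntax (allFin n) f) ⟨
  k * x * ∑ℚ-syntax (allFin n) f         ≡⟨ cong (_* ∑ℚ-syntax (allFin n) f) kx≡c ⟩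
  c * ∑ℚ-syntax (allFin n) f             ≡⟨ ∑-*ˡ c (allFin n) f ⟨
  (∑ℚ[ i ∈ allFin n ] c * f i)           ≡⟨ ∑-cong (allFin n) eq ⟩
  ∑ℚ-syntax (allFin n) (g ∘ toℕ)         ≡⟨ ∑-allFin n g ⟩
  ∑ℚ-syntax (upTo n) g                   ∎
  where open ≡-Reasoning

binom-> : ∀ N .{{_ : NonZero N}} p {k} → N < k → binom N p k ≡ 0ℚ
binom-> N p {k} N<k = trans (cong (_* S) (bin-> N<k)) (ℚₚ.*-zeroˡ S)
  where
  S : ℚ
  -- Unification recovers the hypergeometric sum inside `binom`; the vanishing comes from its factor
  -- `fromℕ (N C k)` alone.
  S = _

module Weights (r′ s : ℕ) where

  private
    r N′ N B : ℕ
    r  = suc r′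
    N′ = r′ ℕ.+ s
    N  = suc N′
    B  = suc (s ⊓ (N ∸ s))

    <B⇒≤s : ∀ {j} → j < B → j ≤ s
    <B⇒≤s j<B = ℕₚ.≤-trans (ℕ.s≤s⁻¹ j<B) (ℕₚ.m⊓n≤m s (N ∸ s))

    <B⇒≤N′ : ∀ {j} → j < B → j ≤ N′
    <B⇒≤N′ j<B = ℕₚ.≤-trans (<B⇒≤s j<B) (ℕₚ.m≤n+m s r′)

    weight : ℕ → ℕ → ℚ
    weight j K = bin r j * bin s j * bin (N′ ∸ j) (N′ ∸ K)

    -- The three numerator factors contribute the cube of (-1)^j j!, while the denominator
    -- contributes one sign and three factorials, so they agree by `sgn²`. The remaining binomials
    -- are related by `complement-revision` for N′ = N - 1.
    term-eq : ∀ {K j} → K ≤ N′ → j ≤ N′ →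
              (fromℕ N * bin N′ K) * (rising (1ℚ - fromℕ (suc K)) j * rising (- fromℕ s) j * rising (fromℕ s - fromℕ N) j)
                ≡ (fromℕ N * weight j K) * ₃F₂-denominator N j
    term-eq {K} {j} K≤N′ j≤N′ = begin
      (n * bin N′ K) * (rising (1ℚ - fromℕ (suc K)) j * rising (- fromℕ s) j * rising (fromℕ s - fromℕ N) j)
        ≡⟨ cong₂ (λ x y → (n * bin N′ K) * (rising x j * rising (- fromℕ s) j * rising y j)) (1-suc K) s-N ⟩
      (n * bin N′ K) * (rising (- fromℕ K) j * rising (- fromℕ s) j * rising (- fromℕ r) j)
        ≡⟨ cong (n * bin N′ K *_) (cong₂ _*_ (cong₂ _*_ (rising-neg K j) (rising-neg s j)) (rising-neg r j)) ⟩
      (n * bin N′ K) * (σ * (F * bin K j) * (σ * (F * bin s j)) * (σ * (F * bin r j)))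
        ≡⟨ solve 7 (λ n x σ F k s r → (n :* x) :* (σ :* (F :* k) :* (σ :* (F :* s)) :* (σ :* (F :* r)))
                      := (σ :* σ) :* (n :* (r :* s) :* (x :* k) :* (σ :* F :* F :* F)))
             refl n (bin N′ K) σ F (bin K j) (bin s j) (bin r j) ⟩
      (σ * σ) * (n * (bin r j * bin s j) * (bin N′ K * bin K j) * (σ * F * F * F))
        ≡⟨ cong₂ (λ x y → x * (n * (bin r j * bin s j) * y * (σ * F * F * F))) (sgn² j) (complement-revision K≤N′ j≤N′) ⟩
      1ℚ * (n * (bin r j * bin s j) * (bin N′ j * bin (N′ ∸ j) (N′ ∸ K)) * (σ * F * F * F))
        ≡⟨ solve 6 (λ n w x y σ F → con 1ℚ :* (n :* w :* (x :* y) :* (σ :* F :* F :* F))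
                      := (n :* (w :* y)) :* (σ :* (F :* x) :* F :* F))
             refl n (bin r j * bin s j) (bin N′ j) (bin (N′ ∸ j) (N′ ∸ K)) σ F ⟩
      (n * weight j K) * (σ * (F * bin N′ j) * F * F)
        ≡⟨ cong₂ (λ x y → (n * weight j K) * (x * y * F)) (trans (cong (λ t → rising t j) (1-suc N′)) (rising-neg N′ j)) rising-1 ⟨
      (n * weight j K) * ₃F₂-denominator N j ∎
      where
      open ≡-Reasoning
      n σ F : ℚ
      n = fromℕ N
      σ = sgn j
      F = fromℕ (j !)
      1-suc : ∀ m → 1ℚ - fromℕ (suc m) ≡ - fromℕ m
      1-suc m = trans (cong (λ t → 1ℚ - t) (fromℕ-suc m)) (solve 1 (λ m → con 1ℚ :- (con 1ℚ :+ m) := :- m) refl (fromℕ m))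
      s-N : fromℕ s - fromℕ N ≡ - fromℕ r
      s-N = trans (cong (λ t → fromℕ s - t) (fromℕ-+ r s)) (solve 2 (λ r s → s :- (r :+ s) := :- r) refl (fromℕ r) (fromℕ s))
      rising-1 : rising 1ℚ j ≡ F
      rising-1 = trans (rising-suc 0 j)
        (trans (cong (F *_) (trans (cong (λ t → bin t j) (ℕₚ.+-identityʳ j)) (bin-n-n j))) (ℚₚ.*-identityʳ F))

  -- The factor K + 1 turns C(N, K+1) into N C(N′, K). The upper index N′ is then the one that the
  -- denominator parameter 1 - N = -N′ brings in.
  binom-weight : ∀ {K} → K ≤ N′ → fromℕ (suc K) * binom (suc r′ ℕ.+ s) s (suc K)
                                ≡ fromℕ N * (∑ℚ[ j ∈ upTo B ] weight j K)
  binom-weight {K} K≤N′ =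
    trans (∑-allFin-cross {k = fromℕ (suc K)} {x = bin N (suc K)} {c = fromℕ N * bin N′ K} (λ j → fromℕ N * weight j K) (bin-absorb-suc N′ K)
            (λ i → ÷-cross (fromℕ N * bin N′ K) _ (₃F₂-denominator N (toℕ i))
                     {{₃F₂-denominator-nonZero N (toℕ i) (s≤s (<B⇒≤N′ (toℕ<n i)))}}
                     (term-eq K≤N′ (<B⇒≤N′ (toℕ<n i)))))
          (∑-*ˡ (fromℕ N) (upTo B) (λ j → weight j K))

  -- Writing N + i - j as (i + 1) + (N′ - j) before applying Vandermonde separates i from j, so the
  -- inner sums are the weights of `binom-weight` and depend on K alone.
  bin-*-bin : ∀ i → bin (r ℕ.+ i) r * bin (s ℕ.+ i) s
                  ≡ (∑ℚ[ K ∈ upTo N ] bin (suc i) (suc K) * (∑ℚ[ j ∈ upTo B ] weight j K))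
  bin-*-bin i = begin
    bin (r ℕ.+ i) r * bin (s ℕ.+ i) s
      ≡⟨ li-shanlan r s i ⟩
    (∑ℚ[ j ∈ upTo (suc s) ] bin r j * bin s j * bin (N ℕ.+ i ∸ j) N)
      -- Since N ∸ s is r, the range of `binom` stops at min(s, r); past it C(s, j) or C(r, j) is
      -- zero.
      ≡⟨ ∑-upTo-extend (λ j → bin r j * bin s j * bin (N ℕ.+ i ∸ j) N) (s≤s (ℕₚ.m⊓n≤m s (N ∸ s))) vanish ⟨
    (∑ℚ[ j ∈ upTo B ] bin r j * bin s j * bin (N ℕ.+ i ∸ j) N)
      ≡⟨ ∑-upTo-cong B (λ j j<B → trans (cong (bin r j * bin s j *_) (expand j (<B⇒≤N′ j<B)))
                                  (trans (sym (∑-*ˡ (bin r j * bin s j) (upTo N) (λ K → bin (suc i) (suc K) * bin (N′ ∸ j) (N′ ∸ K))))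
                                         (∑-cong (upTo N) (rearrange j)))) ⟩
    (∑ℚ[ j ∈ upTo B ] ∑ℚ[ K ∈ upTo N ] bin (suc i) (suc K) * weight j K)
      ≡⟨ ∑-swap (upTo B) (upTo N) (λ j K → bin (suc i) (suc K) * weight j K) ⟩
    (∑ℚ[ K ∈ upTo N ] ∑ℚ[ j ∈ upTo B ] bin (suc i) (suc K) * weight j K)
      ≡⟨ ∑-cong (upTo N) (λ K → ∑-*ˡ (bin (suc i) (suc K)) (upTo B) (λ j → weight j K)) ⟩
    (∑ℚ[ K ∈ upTo N ] bin (suc i) (suc K) * (∑ℚ[ j ∈ upTo B ] weight j K)) ∎
    where
    open ≡-Reasoning

    vanish : ∀ j → B ≤ j → bin r j * bin s j * bin (N ℕ.+ i ∸ j) N ≡ 0ℚ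
    vanish j B≤j = [ s-small , r-small ]′ (ℕₚ.≤-<-connex j r)
      where
      s-small : j ≤ r → bin r j * bin s j * bin (N ℕ.+ i ∸ j) N ≡ 0ℚ
      s-small j≤r = trans (cong (λ t → bin r j * t * bin (N ℕ.+ i ∸ j) N) (bin-> s<j))
                          (solve 2 (λ x y → x :* con 0ℚ :* y := con 0ℚ) refl (bin r j) (bin (N ℕ.+ i ∸ j) N))
        where
        s<j : s < j
        s<j = ℕₚ.≰⇒> (λ j≤s → ℕₚ.<⇒≱ B≤j (ℕₚ.⊓-glb j≤s (subst (j ≤_) (sym (ℕₚ.m+n∸n≡m r s)) j≤r)))
      r-small : r < j → bin r j * bin s j * bin (N ℕ.+ i ∸ j) N ≡ 0ℚ
      r-small r<j = trans (cong (λ t → t * bin s j * bin (N ℕ.+ i ∸ j) N) (bin-> r<j))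
                          (solve 2 (λ x y → con 0ℚ :* x :* y := con 0ℚ) refl (bin s j) (bin (N ℕ.+ i ∸ j) N))

    expand : ∀ j → j ≤ N′ → bin (N ℕ.+ i ∸ j) N ≡ (∑ℚ[ K ∈ upTo N ] bin (suc i) (suc K) * bin (N′ ∸ j) (N′ ∸ K))
    expand j j≤N′ = begin
      bin (N ℕ.+ i ∸ j) N
        ≡⟨ cong (λ t → bin t N) top ⟩
      bin (suc i ℕ.+ (N′ ∸ j)) N
        ≡⟨ vandermonde (suc i) (N′ ∸ j) N ⟨
      conv (bin (suc i)) (bin (N′ ∸ j)) N
        ≡⟨ conv-suc (bin (suc i)) (bin (N′ ∸ j)) N′ ⟩
      1ℚ * bin (N′ ∸ j) N + conv (bin (suc i) ∘ suc) (bin (N′ ∸ j)) N′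
        -- The term k = 0 of Vandermonde vanishes because N′ - j < N. This is why the sum over k
        -- starts at 1.
        ≡⟨ cong (λ t → 1ℚ * t + conv (bin (suc i) ∘ suc) (bin (N′ ∸ j)) N′) (bin-> (s≤s (ℕₚ.m∸n≤m N′ j))) ⟩
      0ℚ + conv (bin (suc i) ∘ suc) (bin (N′ ∸ j)) N′
        ≡⟨ ℚₚ.+-identityˡ (conv (bin (suc i) ∘ suc) (bin (N′ ∸ j)) N′) ⟩
      conv (bin (suc i) ∘ suc) (bin (N′ ∸ j)) N′ ∎
      where
      top : N ℕ.+ i ∸ j ≡ suc i ℕ.+ (N′ ∸ j)
      top = trans (cong (_∸ j) (cong suc (ℕₚ.+-comm N′ i))) (ℕₚ.+-∸-assoc (suc i) j≤N′)

    rearrange : ∀ j K → bin r j * bin s j * (bin (suc i) (suc K) * bin (N′ ∸ j) (N′ ∸ K)) ≡ bin (suc i) (suc K) * weight j K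
    rearrange j K = solve 3 (λ a b c → a :* (b :* c) := b :* (a :* c)) refl (bin r j * bin s j) (bin (suc i) (suc K)) (bin (N′ ∸ j) (N′ ∸ K))

  -- The factor K + 1 spent in `binom-weight` is absorbed by C(i+1, K+1), leaving (i + 1) C(i, K).
  -- The part m = i + 1 thereby splits off, so dividing by it gives a combination of the C(i, K).
  rising-*-rising : ∀ i → fromℕ N * (rising (fromℕ (suc i)) r * rising (fromℕ (suc i)) s)
                        ≡ fromℕ (suc i) * (fromℕ (r ! ℕ.* s !) * (∑ℚ[ K ∈ upTo N ] binom (suc r′ ℕ.+ s) s (suc K) * bin i K))
  rising-*-rising i = begin
    n * (rising (fromℕ (suc i)) r * rising (fromℕ (suc i)) s)
      ≡⟨ cong₂ (λ x y → n * (x * y)) (rising-suc i r) (rising-suc i s) ⟩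
    n * ((fromℕ (r !) * bin (r ℕ.+ i) r) * (fromℕ (s !) * bin (s ℕ.+ i) s))
      ≡⟨ solve 5 (λ n R x S y → n :* ((R :* x) :* (S :* y)) := R :* S :* (n :* (x :* y))) refl n (fromℕ (r !)) (bin (r ℕ.+ i) r) (fromℕ (s !)) (bin (s ℕ.+ i) s) ⟩
    fromℕ (r !) * fromℕ (s !) * (n * (bin (r ℕ.+ i) r * bin (s ℕ.+ i) s))
      ≡⟨ cong₂ (λ x y → x * (n * y)) (sym (fromℕ-* (r !) (s !))) (bin-*-bin i) ⟩
    c * (n * (∑ℚ[ K ∈ upTo N ] bin (suc i) (suc K) * W K))
      ≡⟨ cong (c *_) (∑-*ˡ n (upTo N) (λ K → bin (suc i) (suc K) * W K)) ⟨
    c * (∑ℚ[ K ∈ upTo N ] n * (bin (suc i) (suc K) * W K))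
      ≡⟨ cong (c *_) (∑-upTo-cong N (λ K K<N → term K (ℕ.s≤s⁻¹ K<N))) ⟩
    c * (∑ℚ[ K ∈ upTo N ] fromℕ (suc i) * (q K * bin i K))
      ≡⟨ cong (c *_) (∑-*ˡ (fromℕ (suc i)) (upTo N) (λ K → q K * bin i K)) ⟩
    c * (fromℕ (suc i) * (∑ℚ[ K ∈ upTo N ] q K * bin i K))
      ≡⟨ solve 3 (λ c i Q → c :* (i :* Q) := i :* (c :* Q)) refl c (fromℕ (suc i)) (∑ℚ[ K ∈ upTo N ] q K * bin i K) ⟩
    fromℕ (suc i) * (c * (∑ℚ[ K ∈ upTo N ] q K * bin i K)) ∎
    where
    open ≡-Reasoning
    n c : ℚ
    n = fromℕ N
    c = fromℕ (r ! ℕ.* s !)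
    W q : ℕ → ℚ
    W K = ∑ℚ[ j ∈ upTo B ] weight j K
    q K = binom (suc r′ ℕ.+ s) s (suc K)
    term : ∀ K → K ≤ N′ → n * (bin (suc i) (suc K) * W K) ≡ fromℕ (suc i) * (q K * bin i K)
    term K K≤N′ = begin
      n * (bin (suc i) (suc K) * W K)
        ≡⟨ solve 3 (λ n b W → n :* (b :* W) := n :* W :* b) refl n (bin (suc i) (suc K)) (W K) ⟩
      n * W K * bin (suc i) (suc K)
        ≡⟨ cong (_* bin (suc i) (suc K)) (binom-weight K≤N′) ⟨
      fromℕ (suc K) * q K * bin (suc i) (suc K)
        ≡⟨ solve 3 (λ k q b → k :* q :* b := q :* (k :* b)) refl (fromℕ (suc K)) (q K) (bin (suc i) (suc K)) ⟩
      q K * (fromℕ (suc K) * bin (suc i) (suc K))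
        ≡⟨ cong (q K *_) (bin-absorb-suc i K) ⟩
      q K * (fromℕ (suc i) * bin i K)
        ≡⟨ solve 3 (λ q i b → q :* (i :* b) := i :* (q :* b)) refl (q K) (fromℕ (suc i)) (bin i K) ⟩
      fromℕ (suc i) * (q K * bin i K) ∎

-- Polynomials as functions

eval : ℚ[X] → ℚ → ℚ
eval []      x = 0ℚ
eval (a ∷ f) x = a + x * eval f x

eval-⊕ : ∀ f g x → eval (f ⊕ g) x ≡ eval f x + eval g x
eval-⊕ []      g       x = sym (ℚₚ.+-identityˡ (eval g x))
eval-⊕ (a ∷ f) []      x = sym (ℚₚ.+-identityʳ (a + x * eval f x))
eval-⊕ (a ∷ f) (b ∷ g) x = trans (cong (λ t → a + b + x * t) (eval-⊕ f g x))
  (solve 5 (λ a b x f g → a :+ b :+ x :* (f :+ g) := (a :+ x :* f) :+ (b :+ x :* g)) refl a b x (eval f x) (eval g x))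

eval-· : ∀ c f x → eval (c · f) x ≡ c * eval f x
eval-· c []      x = sym (ℚₚ.*-zeroʳ c)
eval-· c (a ∷ f) x = trans (cong (λ t → c * a + x * t) (eval-· c f x))
  (solve 4 (λ c a x f → c :* a :+ x :* (c :* f) := c :* (a :+ x :* f)) refl c a x (eval f x))

eval-⊖ : ∀ f x → eval (⊖ f) x ≡ - eval f x
eval-⊖ []      x = refl
eval-⊖ (a ∷ f) x = trans (cong (λ t → - a + x * t) (eval-⊖ f x))
  (solve 3 (λ a x f → (:- a) :+ x :* (:- f) := :- (a :+ x :* f)) refl a x (eval f x))

eval-⊗ : ∀ f g x → eval (f ⊗ g) x ≡ eval f x * eval g x
eval-⊗ []      g x = sym (ℚₚ.*-zeroˡ (eval g x))
eval-⊗ (a ∷ f) g x = begin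
  eval ((a · g) ⊕ (0ℚ ∷ f ⊗ g)) x                  ≡⟨ eval-⊕ (a · g) (0ℚ ∷ f ⊗ g) x ⟩
  eval (a · g) x + (0ℚ + x * eval (f ⊗ g) x)       ≡⟨ cong₂ (λ t u → t + (0ℚ + x * u)) (eval-· a g x) (eval-⊗ f g x) ⟩
  a * eval g x + (0ℚ + x * (eval f x * eval g x))  ≡⟨ solve 4 (λ a x f g → a :* g :+ (con 0ℚ :+ x :* (f :* g)) := (a :+ x :* f) :* g) refl a x (eval f x) (eval g x) ⟩
  (a + x * eval f x) * eval g x                    ∎
  where open ≡-Reasoning

eval-const : ∀ a x → eval (const a) x ≡ a
eval-const = solve 2 (λ a x → a :+ x :* con 0ℚ := a) refl

eval-X : ∀ x → eval X x ≡ x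
eval-X = solve 1 (λ x → con 0ℚ :+ x :* (con 1ℚ :+ x :* con 0ℚ) := x) refl

eval-X^ : ∀ k x → eval (X ^ₚ k) x ≡ x ^ k
eval-X^ zero    x = eval-const 1ℚ x
eval-X^ (suc k) x = trans (eval-⊗ X (X ^ₚ k) x) (cong₂ _*_ (eval-X x) (eval-X^ k x))

eval-∑ : ∀ {a} {A : Set a} xs (F : A → ℚ[X]) x → eval (∑-syntax xs F) x ≡ (∑ℚ[ y ∈ xs ] eval (F y) x)
eval-∑ []       F x = refl
eval-∑ (y ∷ ys) F x = trans (eval-⊕ (F y) (∑-syntax ys F) x) (cong (eval (F y) x +_) (eval-∑ ys F x))

-- Both sides obey one recursion: the new factor Y - j takes the value b - j, the factor in
-- `bin-absorb`. This also covers j > b, where both sides vanish.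
eval-falling : ∀ Y x b j → eval Y x ≡ fromℕ b → eval (falling Y j) x ≡ fromℕ (j !) * bin b j
eval-falling Y x b zero    eq = eval-const 1ℚ x
eval-falling Y x b (suc j) eq = begin
  eval (falling Y j ⊗ (Y ⊖ const (fromℕ j))) x
    ≡⟨ eval-⊗ (falling Y j) (Y ⊖ const (fromℕ j)) x ⟩
  eval (falling Y j) x * eval (Y ⊖ const (fromℕ j)) x
    ≡⟨ cong₂ _*_ (eval-falling Y x b j eq) factor ⟩
  fromℕ (j !) * bin b j * (fromℕ b - fromℕ j)
    ≡⟨ solve 3 (λ F b d → F :* b :* d := F :* (d :* b)) refl (fromℕ (j !)) (bin b j) (fromℕ b - fromℕ j) ⟩
  fromℕ (j !) * ((fromℕ b - fromℕ j) * bin b j)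
    ≡⟨ cong (fromℕ (j !) *_) (bin-absorb b j) ⟨
  fromℕ (j !) * (fromℕ (suc j) * bin b (suc j))
    ≡⟨ solve 3 (λ F s b → F :* (s :* b) := s :* F :* b) refl (fromℕ (j !)) (fromℕ (suc j)) (bin b (suc j)) ⟩
  fromℕ (suc j) * fromℕ (j !) * bin b (suc j)
    ≡⟨ cong (_* bin b (suc j)) (fromℕ-* (suc j) (j !)) ⟨
  fromℕ (suc j !) * bin b (suc j) ∎
  where
  open ≡-Reasoning
  factor : eval (Y ⊖ const (fromℕ j)) x ≡ fromℕ b - fromℕ j
  factor = trans (eval-⊕ Y (⊖ const (fromℕ j)) x)
                 (cong₂ _+_ eq (trans (eval-⊖ (const (fromℕ j)) x) (cong -_ (eval-const (fromℕ j) x))))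

eval-choose : ∀ Y x b j → eval Y x ≡ fromℕ b → eval (choose Y j) x ≡ bin b j
eval-choose Y x b j eq = begin
  eval (choose Y j) x                ≡⟨ eval-· 1/j! (falling Y j) x ⟩
  1/j! * eval (falling Y j) x        ≡⟨ cong (1/j! *_) (eval-falling Y x b j eq) ⟩
  1/j! * (fromℕ (j !) * bin b j)     ≡⟨ ℚₚ.*-assoc 1/j! (fromℕ (j !)) (bin b j) ⟨
  1/j! * fromℕ (j !) * bin b j       ≡⟨ cong (_* bin b j) (/-*-fromℕ 1 (j !) {{j ℕₚ.!≢0}}) ⟩
  1ℚ * bin b j                       ≡⟨ ℚₚ.*-identityˡ (bin b j) ⟩
  bin b j                            ∎
  where
  open ≡-Reasoning
  1/j! : ℚ
  1/j! = (ℤ.+ 1 / j !) {{j ℕₚ.!≢0}}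

-- Polynomials are determined by their values

coeff-⊕ : ∀ f g i → coeff (f ⊕ g) i ≡ coeff f i + coeff g i
coeff-⊕ []      g       i       = sym (ℚₚ.+-identityˡ (coeff g i))
coeff-⊕ (a ∷ f) []      i       = sym (ℚₚ.+-identityʳ (coeff (a ∷ f) i))
coeff-⊕ (a ∷ f) (b ∷ g) zero    = refl
coeff-⊕ (a ∷ f) (b ∷ g) (suc i) = coeff-⊕ f g i

coeff-⊖ : ∀ f i → coeff (⊖ f) i ≡ - coeff f i
coeff-⊖ []      i       = refl
coeff-⊖ (a ∷ f) zero    = refl
coeff-⊖ (a ∷ f) (suc i) = coeff-⊖ f i

-- The coefficients of the quotient of X f by X - c, by Horner's scheme.
horner : ℚ → ℚ[X] → ℚ[X]
horner c []      = []
horner c (a ∷ f) = eval (a ∷ f) c ∷ horner c f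

length-horner : ∀ c f → length (horner c f) ≡ length f
length-horner c []      = refl
length-horner c (a ∷ f) = cong suc (length-horner c f)

-- The factor theorem for X f, with the remainder c f(c) kept on the right. A constant term added to
-- X f cancels in this difference, so the equation serves for `a ∷ f` too.
eval-horner : ∀ c f x → (x - c) * eval (horner c f) x ≡ x * eval f x - c * eval f c
eval-horner c []      x = solve 2 (λ x c → (x :- c) :* con 0ℚ := x :* con 0ℚ :- c :* con 0ℚ) refl x c
eval-horner c (a ∷ f) x = begin
  (x - c) * (E + x * eval (horner c f) x)
    ≡⟨ solve 4 (λ x c E h → (x :- c) :* (E :+ x :* h) := (x :- c) :* E :+ x :* ((x :- c) :* h)) refl x c E (eval (horner c f) x) ⟩
  (x - c) * E + x * ((x - c) * eval (horner c f) x)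
    ≡⟨ cong (λ t → (x - c) * E + x * t) (eval-horner c f x) ⟩
  (x - c) * (a + c * eval f c) + x * (x * eval f x - c * eval f c)
    ≡⟨ solve 5 (λ x c a u v → (x :- c) :* (a :+ c :* v) :+ x :* (x :* u :- c :* v) := x :* (a :+ x :* u) :- c :* (a :+ c :* v)) refl x c a (eval f x) (eval f c) ⟩
  x * (a + x * eval f x) - c * E ∎
  where
  open ≡-Reasoning
  E : ℚ
  E = eval (a ∷ f) c

-- The entries of `horner c f` are the values at c of the successive tails of f. Each coefficient of
-- f is the value of its tail minus c times the value of the next tail, hence zero when all these
-- values are.
horner≈0 : ∀ c f → horner c f ≈ [] → f ≈ [] × eval f c ≡ 0ℚ
horner≈0 c []      h≈0 = (λ i → refl) , refl
horner≈0 c (a ∷ f) h≈0 = f≈0 , h≈0 0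
  where
  ih : f ≈ [] × eval f c ≡ 0ℚ
  ih = horner≈0 c f (h≈0 ∘ suc)
  f≈0 : a ∷ f ≈ []
  f≈0 zero    = begin
    a                   ≡⟨ solve 2 (λ a c → a := a :+ c :* con 0ℚ) refl a c ⟩
    a + c * 0ℚ          ≡⟨ cong (λ t → a + c * t) (proj₂ ih) ⟨
    a + c * eval f c    ≡⟨ h≈0 0 ⟩
    0ℚ                  ∎
    where open ≡-Reasoning
  f≈0 (suc i) = proj₁ ih i

-- A polynomial with zeros c, c+1, c+2, ... is divided by X - c; the quotient `horner (fromℕ c) f`
-- is shorter and has zeros from c + 1 on. The length bound `n` drives the recursion, as the
-- quotient is not a subterm.
vanishing⇒≈0 : ∀ n f c → length f ≤ n → (∀ d → eval f (fromℕ (d ℕ.+ c)) ≡ 0ℚ) → f ≈ []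
vanishing⇒≈0 n       []      c _         vanish i = refl
vanishing⇒≈0 (suc n) (a ∷ f) c (s≤s f≤n) vanish   = a∷f≈0
  where
  open ≡-Reasoning
  horner-vanish : ∀ d → eval (horner (fromℕ c) f) (fromℕ (d ℕ.+ suc c)) ≡ 0ℚ
  horner-vanish d = fromℕ-cancel (suc d) (begin
    fromℕ (suc d) * eval (horner (fromℕ c) f) x
      ≡⟨ cong (_* eval (horner (fromℕ c) f) x) (begin
           fromℕ (suc d)                         ≡⟨ solve 2 (λ d c → d := d :+ c :- c) refl (fromℕ (suc d)) (fromℕ c) ⟩
           fromℕ (suc d) + fromℕ c - fromℕ c     ≡⟨ cong (_- fromℕ c) (fromℕ-+ (suc d) c) ⟨
           fromℕ (suc d ℕ.+ c) - fromℕ c         ≡⟨ cong (λ t → fromℕ t - fromℕ c) (ℕₚ.+-suc d c) ⟨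
           x - fromℕ c                           ∎) ⟩
    (x - fromℕ c) * eval (horner (fromℕ c) f) x
      ≡⟨ eval-horner (fromℕ c) f x ⟩
    x * eval f x - fromℕ c * eval f (fromℕ c)
      ≡⟨ solve 3 (λ a u v → u :- v := (a :+ u) :- (a :+ v)) refl a (x * eval f x) (fromℕ c * eval f (fromℕ c)) ⟩
    eval (a ∷ f) x - eval (a ∷ f) (fromℕ c)
      ≡⟨ cong₂ _-_ (trans (cong (eval (a ∷ f) ∘ fromℕ) (ℕₚ.+-suc d c)) (vanish (suc d))) (vanish 0) ⟩
    0ℚ
      ≡⟨ ℚₚ.*-zeroʳ (fromℕ (suc d)) ⟨
    fromℕ (suc d) * 0ℚ ∎)
    where
    x : ℚ
    x = fromℕ (d ℕ.+ suc c)
  zeros : f ≈ [] × eval f (fromℕ c) ≡ 0ℚ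
  zeros = horner≈0 (fromℕ c) f
    (vanishing⇒≈0 n (horner (fromℕ c) f) (suc c) (subst (_≤ n) (sym (length-horner (fromℕ c) f)) f≤n) horner-vanish)
  a≡0 : a ≡ 0ℚ
  a≡0 = begin
    a                                    ≡⟨ solve 2 (λ a c → a := a :+ c :* con 0ℚ) refl a (fromℕ c) ⟩
    a + fromℕ c * 0ℚ                     ≡⟨ cong (λ t → a + fromℕ c * t) (proj₂ zeros) ⟨
    a + fromℕ c * eval f (fromℕ c)       ≡⟨ vanish 0 ⟩
    0ℚ                                   ∎
  a∷f≈0 : a ∷ f ≈ []
  a∷f≈0 zero    = a≡0
  a∷f≈0 (suc i) = proj₁ zeros i

eval-injective : ∀ f g → (∀ a → eval f (fromℕ (suc a)) ≡ eval g (fromℕ (suc a))) → f ≈ g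
eval-injective f g eq i = begin
  coeff f i                              ≡⟨ solve 2 (λ f g → f := (f :+ :- g) :+ g) refl (coeff f i) (coeff g i) ⟩
  coeff f i + - coeff g i + coeff g i    ≡⟨ cong (λ t → coeff f i + t + coeff g i) (coeff-⊖ g i) ⟨
  coeff f i + coeff (⊖ g) i + coeff g i  ≡⟨ cong (_+ coeff g i) (coeff-⊕ f (⊖ g) i) ⟨
  coeff (f ⊖ g) i + coeff g i            ≡⟨ cong (_+ coeff g i) (vanishing⇒≈0 (length (f ⊖ g)) (f ⊖ g) 1 ℕₚ.≤-refl vanish i) ⟩
  0ℚ + coeff g i                         ≡⟨ ℚₚ.+-identityˡ (coeff g i) ⟩
  coeff g i                              ∎
  where
  open ≡-Reasoning
  vanish : ∀ d → eval (f ⊖ g) (fromℕ (d ℕ.+ 1)) ≡ 0ℚ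
  vanish d = begin
    eval (f ⊖ g) x          ≡⟨ eval-⊕ f (⊖ g) x ⟩
    eval f x + eval (⊖ g) x ≡⟨ cong (eval f x +_) (eval-⊖ g x) ⟩
    eval f x - eval g x     ≡⟨ cong (_- eval g x) (subst (λ t → eval f (fromℕ t) ≡ eval g (fromℕ t)) (ℕₚ.+-comm 1 d) (eq d)) ⟩
    eval g x - eval g x     ≡⟨ ℚₚ.+-inverseʳ (eval g x) ⟩
    0ℚ                      ∎
    where
    x : ℚ
    x = fromℕ (d ℕ.+ 1)

-- Sums over partitions

multiplicity-++ : ∀ i μ ν → multiplicity i (μ ++ ν) ≡ multiplicity i μ ℕ.+ multiplicity i ν
multiplicity-++ i μ ν = trans (cong length (Listₚ.filter-++ (ℕₚ._≟ i) μ ν)) (Listₚ.length-++ (filter (ℕₚ._≟ i) μ))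

multiplicity-none : ∀ {i μ} → All (_≢ i) μ → multiplicity i μ ≡ 0
multiplicity-none {i} all≢ = cong length (Listₚ.filter-none (ℕₚ._≟ i) all≢)

multiplicity-replicate : ∀ k i → multiplicity i (replicate k i) ≡ k
multiplicity-replicate k i = trans
  (cong length (Listₚ.filter-all (ℕₚ._≟ i) (Allₚ.replicate⁺ k refl))) (Listₚ.length-replicate k)

multiplicity-> : ∀ {i B μ} → B < i → All (_≤ B) μ → multiplicity i μ ≡ 0
multiplicity-> B<i = multiplicity-none ∘ All.map (λ x≤B → ℕₚ.<⇒≢ (ℕₚ.≤-<-trans x≤B B<i))

z-factor : List ℕ → ℕ → ℕ
z-factor μ i = i ℕ.^ multiplicity i μ ℕ.* multiplicity i μ !

-- The product in `z` runs up to the weight, which changes when parts are removed. A free bound lets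
-- the products for μ and for what remains of it be compared factor by factor.
z-upTo : ℕ → List ℕ → ℕ
z-upTo B μ = product (map (z-factor μ) (range₁ B))

z-upTo-suc : ∀ B μ → z-upTo (suc B) μ ≡ z-upTo B μ ℕ.* z-factor μ (suc B)
z-upTo-suc B μ = begin
  product (map (z-factor μ) (map suc (upTo (suc B))))
    ≡⟨ cong (λ is → product (map (z-factor μ) (map suc is))) (Listₚ.upTo-∷ʳ B) ⟨
  product (map (z-factor μ) (map suc (upTo B ++ B ∷ [])))
    ≡⟨ cong (product ∘ map (z-factor μ)) (Listₚ.map-++ suc (upTo B) (B ∷ [])) ⟩
  product (map (z-factor μ) (range₁ B ++ suc B ∷ []))
    ≡⟨ cong product (Listₚ.map-++ (z-factor μ) (range₁ B) (suc B ∷ [])) ⟩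
  product (map (z-factor μ) (range₁ B) ++ z-factor μ (suc B) ∷ [])
    ≡⟨ product-++ (map (z-factor μ) (range₁ B)) (z-factor μ (suc B) ∷ []) ⟩
  z-upTo B μ ℕ.* (z-factor μ (suc B) ℕ.* 1)
    ≡⟨ cong (z-upTo B μ ℕ.*_) (ℕₚ.*-identityʳ (z-factor μ (suc B))) ⟩
  z-upTo B μ ℕ.* z-factor μ (suc B) ∎
  where open ≡-Reasoning

z-upTo-cong : ∀ B μ ν → (∀ i → i ≤ B → multiplicity i μ ≡ multiplicity i ν) → z-upTo B μ ≡ z-upTo B ν
z-upTo-cong zero    μ ν eq = refl
z-upTo-cong (suc B) μ ν eq = begin
  z-upTo (suc B) μ                     ≡⟨ z-upTo-suc B μ ⟩
  z-upTo B μ ℕ.* z-factor μ (suc B)    ≡⟨ cong₂ (λ t m → t ℕ.* (suc B ℕ.^ m ℕ.* m !)) (z-upTo-cong B μ ν (λ i i≤B → eq i (ℕₚ.m≤n⇒m≤1+n i≤B))) (eq (suc B) ℕₚ.≤-refl) ⟩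
  z-upTo B ν ℕ.* z-factor ν (suc B)    ≡⟨ z-upTo-suc B ν ⟨
  z-upTo (suc B) ν                     ∎
  where open ≡-Reasoning

z-upTo-bounded : ∀ d {B μ} → All (_≤ B) μ → z-upTo (d ℕ.+ B) μ ≡ z-upTo B μ
z-upTo-bounded zero            μ≤B = refl
z-upTo-bounded (suc d) {B} {μ} μ≤B = begin
  z-upTo (suc (d ℕ.+ B)) μ                            ≡⟨ z-upTo-suc (d ℕ.+ B) μ ⟩
  z-upTo (d ℕ.+ B) μ ℕ.* z-factor μ (suc (d ℕ.+ B))
    ≡⟨ cong₂ (λ t m → t ℕ.* (suc (d ℕ.+ B) ℕ.^ m ℕ.* m !)) (z-upTo-bounded d μ≤B) (multiplicity-> (s≤s (ℕₚ.m≤n+m B d)) μ≤B) ⟩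
  z-upTo B μ ℕ.* 1                                    ≡⟨ ℕₚ.*-identityʳ (z-upTo B μ) ⟩
  z-upTo B μ                                          ∎
  where open ≡-Reasoning

parts≤sum : ∀ μ → All (_≤ sum μ) μ
parts≤sum []      = []
parts≤sum (m ∷ μ) = ℕₚ.m≤m+n m (sum μ) ∷ All.map (λ i≤ → ℕₚ.≤-trans i≤ (ℕₚ.m≤n+m (sum μ) m)) (parts≤sum μ)

-- Both bounds are raised to their sum. The extra indices exceed every part, so their factors are
-- i^0 0! = 1.
z≡z-upTo : ∀ {B μ} → All (_≤ B) μ → z μ ≡ z-upTo B μ
z≡z-upTo {B} {μ} μ≤B = begin
  z-upTo (sum μ) μ           ≡⟨ z-upTo-bounded B (parts≤sum μ) ⟨
  z-upTo (B ℕ.+ sum μ) μ     ≡⟨ cong (λ t → z-upTo t μ) (ℕₚ.+-comm B (sum μ)) ⟩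
  z-upTo (sum μ ℕ.+ B) μ     ≡⟨ z-upTo-bounded (sum μ) μ≤B ⟩
  z-upTo B μ                 ∎
  where open ≡-Reasoning

z-replicate-++ : ∀ k {M ν} → All (_≤ M) ν → z (replicate k (suc M) ++ ν) ≡ z ν ℕ.* (suc M ℕ.^ k ℕ.* k !)
z-replicate-++ k {M} {ν} ν≤M = begin
  z μ
    ≡⟨ z≡z-upTo (Allₚ.++⁺ (Allₚ.replicate⁺ k ℕₚ.≤-refl) (All.map ℕₚ.m≤n⇒m≤1+n ν≤M)) ⟩
  z-upTo (suc M) μ
    ≡⟨ z-upTo-suc M μ ⟩
  z-upTo M μ ℕ.* z-factor μ (suc M)
    ≡⟨ cong₂ (λ t m → t ℕ.* (suc M ℕ.^ m ℕ.* m !)) (z-upTo-cong M μ ν below) top ⟩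
  z-upTo M ν ℕ.* (suc M ℕ.^ k ℕ.* k !)
    ≡⟨ cong (ℕ._* (suc M ℕ.^ k ℕ.* k !)) (z≡z-upTo ν≤M) ⟨
  z ν ℕ.* (suc M ℕ.^ k ℕ.* k !) ∎
  where
  open ≡-Reasoning
  μ : List ℕ
  μ = replicate k (suc M) ++ ν
  below : ∀ i → i ≤ M → multiplicity i μ ≡ multiplicity i ν
  below i i≤M = trans (multiplicity-++ i (replicate k (suc M)) ν)
    (cong (ℕ._+ multiplicity i ν) (multiplicity-none (Allₚ.replicate⁺ k (ℕₚ.<⇒≢ (s≤s i≤M) ∘ sym))))
  top : multiplicity (suc M) μ ≡ k
  top = trans (multiplicity-++ (suc M) (replicate k (suc M)) ν)
    (trans (cong₂ ℕ._+_ (multiplicity-replicate k (suc M)) (multiplicity-> ℕₚ.≤-refl ν≤M)) (ℕₚ.+-identityʳ k))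

block-nonZero : ∀ M k → NonZero (suc M ℕ.^ k ℕ.* k !)
block-nonZero M k = ℕₚ.m*n≢0 _ _ {{ℕₚ.m^n≢0 (suc M) k}} {{k ℕₚ.!≢0}}

1/block : ℕ → ℕ → ℚ
1/block M k = (ℤ.+ 1 / (suc M ℕ.^ k ℕ.* k !)) {{block-nonZero M k}}

1/block-inverse : ∀ M k → 1/block M k * fromℕ (suc M ℕ.^ k ℕ.* k !) ≡ 1ℚ
1/block-inverse M k = /-*-fromℕ 1 (suc M ℕ.^ k ℕ.* k !) {{block-nonZero M k}}

1/z-inverse : ∀ μ → 1/z μ * fromℕ (z μ) ≡ 1ℚ
1/z-inverse μ = /-*-fromℕ 1 (z μ) {{z-nonZero μ}}

1/z-replicate-++ : ∀ k {M ν} → All (_≤ M) ν → 1/z (replicate k (suc M) ++ ν) ≡ 1/block M k * 1/z ν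
1/z-replicate-++ k {M} {ν} ν≤M = fromℕ-cancel (z μ) {{z-nonZero μ}} (begin
  fromℕ (z μ) * 1/z μ                            ≡⟨ ℚₚ.*-comm (fromℕ (z μ)) (1/z μ) ⟩
  1/z μ * fromℕ (z μ)                            ≡⟨ 1/z-inverse μ ⟩
  1ℚ * 1ℚ                                        ≡⟨ cong₂ _*_ (1/block-inverse M k) (1/z-inverse ν) ⟨
  (1/block M k * b) * (1/z ν * fromℕ (z ν))      ≡⟨ solve 4 (λ u b v z → (u :* b) :* (v :* z) := (z :* b) :* (u :* v)) refl (1/block M k) b (1/z ν) (fromℕ (z ν)) ⟩
  (fromℕ (z ν) * b) * (1/block M k * 1/z ν)      ≡⟨ cong (_* (1/block M k * 1/z ν)) (trans (cong fromℕ (z-replicate-++ k ν≤M)) (fromℕ-* (z ν) (suc M ℕ.^ k ℕ.* k !))) ⟨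
  fromℕ (z μ) * (1/block M k * 1/z ν)            ∎)
  where
  open ≡-Reasoning
  μ : List ℕ
  μ = replicate k (suc M) ++ ν
  b : ℚ
  b = fromℕ (suc M ℕ.^ k ℕ.* k !)

1/block-suc : ∀ M k → 1/block M (suc k) * fromℕ (suc k) * fromℕ (suc M) ≡ 1/block M k
1/block-suc M k = fromℕ-cancel b {{block-nonZero M k}} (begin
  fromℕ b * (1/block M (suc k) * fromℕ (suc k) * fromℕ (suc M))
    ≡⟨ solve 4 (λ b u k m → b :* (u :* k :* m) := u :* (m :* k :* b)) refl (fromℕ b) (1/block M (suc k)) (fromℕ (suc k)) (fromℕ (suc M)) ⟩
  1/block M (suc k) * (fromℕ (suc M) * fromℕ (suc k) * fromℕ b)
    ≡⟨ cong (1/block M (suc k) *_) (trans (cong (_* fromℕ b) (sym (fromℕ-* (suc M) (suc k)))) (sym (fromℕ-* (suc M ℕ.* suc k) b))) ⟩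
  1/block M (suc k) * fromℕ (suc M ℕ.* suc k ℕ.* b)
    ≡⟨ cong (λ t → 1/block M (suc k) * fromℕ t) (ℕₚ.[m*n]*[o*p]≡[m*o]*[n*p] (suc M) (suc k) (suc M ℕ.^ k) (k !)) ⟩
  1/block M (suc k) * fromℕ (suc M ℕ.^ suc k ℕ.* suc k !)
    ≡⟨ 1/block-inverse M (suc k) ⟩
  1ℚ
    ≡⟨ trans (ℚₚ.*-comm (fromℕ b) (1/block M k)) (1/block-inverse M k) ⟨
  fromℕ b * 1/block M k ∎)
  where
  open ≡-Reasoning
  b : ℕ
  b = suc M ℕ.^ k ℕ.* k !

partitionsUpTo-sound : ∀ M n → All (λ μ → All (_≤ M) μ × sum μ ≡ n) (partitionsUpTo M n)
partitionsUpTo-sound zero    zero    = ([] , refl) ∷ []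
partitionsUpTo-sound zero    (suc n) = []
partitionsUpTo-sound (suc M) n       = Allₚ.concat⁺ (Allₚ.map⁺ (Allₚ.applyUpTo⁺₁ id (suc (n ℕ./ suc M)) block))
  where
  block : ∀ {k} → k < suc (n ℕ./ suc M) → All (λ μ → All (_≤ suc M) μ × sum μ ≡ n)
            (map (replicate k (suc M) ++_) (partitionsUpTo M (n ∸ k ℕ.* suc M)))
  block {k} k< = Allₚ.map⁺ (All.map prepend (partitionsUpTo-sound M (n ∸ k ℕ.* suc M)))
    where
    sum-replicate : ∀ k → sum (replicate k (suc M)) ≡ k ℕ.* suc M
    sum-replicate zero    = refl
    sum-replicate (suc k) = cong (suc M ℕ.+_) (sum-replicate k)
    prepend : ∀ {ν} → All (_≤ M) ν × sum ν ≡ n ∸ k ℕ.* suc M →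
              All (_≤ suc M) (replicate k (suc M) ++ ν) × sum (replicate k (suc M) ++ ν) ≡ n
    prepend {ν} (ν≤M , eq) =
      Allₚ.++⁺ (Allₚ.replicate⁺ k ℕₚ.≤-refl) (All.map ℕₚ.m≤n⇒m≤1+n ν≤M) ,
      trans (sum-++ (replicate k (suc M)) ν) (trans (cong₂ ℕ._+_ (sum-replicate k) eq)
        (ℕₚ.m+[n∸m]≡n (ℕₚ.≤-trans (ℕₚ.*-monoˡ-≤ (suc M) (ℕ.s≤s⁻¹ k<)) (m/n*n≤m n (suc M)))))

-- Multiplication of the series Σₙ F n qⁿ by qᵃ.
shift : ℕ → (ℕ → ℚ) → ℕ → ℚ
shift zero    F n       = F n
shift (suc a) F zero    = 0ℚ
shift (suc a) F (suc n) = shift a F n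

shift-≤ : ∀ a {n} F → a ≤ n → shift a F n ≡ F (n ∸ a)
shift-≤ zero    F _         = refl
shift-≤ (suc a) F (s≤s a≤n) = shift-≤ a F a≤n

shift-> : ∀ a {n} F → n < a → shift a F n ≡ 0ℚ
shift-> (suc a) {zero}  F _         = refl
shift-> (suc a) {suc n} F (s≤s n<a) = shift-> a F n<a

shift-cong : ∀ a {F F′} n → (∀ i → i ≤ n → F i ≡ F′ i) → shift a F n ≡ shift a F′ n
shift-cong zero    n       eq = eq n ℕₚ.≤-refl
shift-cong (suc a) zero    eq = refl
shift-cong (suc a) (suc n) eq = shift-cong a n (λ i i≤n → eq i (ℕₚ.m≤n⇒m≤1+n i≤n))

shift-suc-cong : ∀ a {F F′} n → (∀ i → i < n → F i ≡ F′ i) → shift (suc a) F n ≡ shift (suc a) F′ n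
shift-suc-cong a zero    eq = refl
shift-suc-cong a (suc n) eq = shift-cong a n (λ i i≤n → eq i (s≤s i≤n))

shift-+ : ∀ a b F n → shift (a ℕ.+ b) F n ≡ shift a (shift b F) n
shift-+ zero    b F n       = refl
shift-+ (suc a) b F zero    = refl
shift-+ (suc a) b F (suc n) = shift-+ a b F n

shift-comm : ∀ a b F n → shift a (shift b F) n ≡ shift b (shift a F) n
shift-comm a b F n = trans (sym (shift-+ a b F n)) (trans (cong (λ t → shift t F n) (ℕₚ.+-comm a b)) (shift-+ b a F n))

shift-* : ∀ a c F n → shift a (λ i → c * F i) n ≡ c * shift a F n
shift-* zero    c F n       = refl
shift-* (suc a) c F zero    = sym (ℚₚ.*-zeroʳ c)
shift-* (suc a) c F (suc n) = shift-* a c F n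

shift-distrib-+ : ∀ a F F′ n → shift a (λ i → F i + F′ i) n ≡ shift a F n + shift a F′ n
shift-distrib-+ zero    F F′ n       = refl
shift-distrib-+ (suc a) F F′ zero    = refl
shift-distrib-+ (suc a) F F′ (suc n) = shift-distrib-+ a F F′ n

shift-linear : ∀ {b} {B : Set b} a (xs : List B) (c : B → ℚ) (F : B → ℕ → ℚ) n →
               shift a (λ i → ∑ℚ[ x ∈ xs ] c x * F x i) n ≡ (∑ℚ[ x ∈ xs ] c x * shift a (F x) n)
shift-linear zero    xs c F n       = refl
shift-linear (suc a) xs c F zero    = sym (trans (∑-cong xs (λ x → ℚₚ.*-zeroʳ (c x))) (∑-0 xs))
shift-linear (suc a) xs c F (suc n) = shift-linear a xs c F n

-- For too large a multiplicity `shift` gives 0, whereas `n ∸ k ℕ.* suc M` would truncate to 0 and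
-- count spurious partitions. The cutoff may therefore be any B above n, the same for all part
-- sizes, which permits exchanging sums.
∑-partitionsUpTo-suc : ∀ M {n B} (φ : List ℕ → ℚ) → n < B →
  ∑ℚ-syntax (partitionsUpTo (suc M) n) φ
    ≡ (∑ℚ[ k ∈ upTo B ] shift (k ℕ.* suc M) (λ i → ∑ℚ[ ν ∈ partitionsUpTo M i ] φ (replicate k (suc M) ++ ν)) n)
∑-partitionsUpTo-suc M {n} {B} φ n<B = begin
  ∑ℚ-syntax (partitionsUpTo (suc M) n) φ
    ≡⟨ ∑-concatMap (λ k → map (replicate k (suc M) ++_) (partitionsUpTo M (n ∸ k ℕ.* suc M))) (upTo (suc (n ℕ./ suc M))) φ ⟩
  (∑ℚ[ k ∈ upTo (suc (n ℕ./ suc M)) ] ∑ℚ-syntax (map (replicate k (suc M) ++_) (partitionsUpTo M (n ∸ k ℕ.* suc M))) φ)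
    ≡⟨ ∑-upTo-cong (suc (n ℕ./ suc M)) (λ k k< → trans
         (∑-map (replicate k (suc M) ++_) (partitionsUpTo M (n ∸ k ℕ.* suc M)) φ)
         (sym (shift-≤ (k ℕ.* suc M) (Φ k) (ℕₚ.≤-trans (ℕₚ.*-monoˡ-≤ (suc M) (ℕ.s≤s⁻¹ k<)) (m/n*n≤m n (suc M)))))) ⟩
  (∑ℚ[ k ∈ upTo (suc (n ℕ./ suc M)) ] shift (k ℕ.* suc M) (Φ k) n)
    ≡⟨ ∑-upTo-extend (λ k → shift (k ℕ.* suc M) (Φ k) n) (ℕₚ.≤-<-trans (m/n≤m n (suc M)) n<B)
         (λ k n/< → shift-> (k ℕ.* suc M) (Φ k) (n< k n/<)) ⟩
  (∑ℚ[ k ∈ upTo B ] shift (k ℕ.* suc M) (Φ k) n) ∎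
  where
  open ≡-Reasoning
  Φ : ℕ → ℕ → ℚ
  Φ k i = ∑ℚ[ ν ∈ partitionsUpTo M i ] φ (replicate k (suc M) ++ ν)
  n< : ∀ k → n ℕ./ suc M < k → n < k ℕ.* suc M
  n< k n/<k = ℕₚ.<-≤-trans
    (subst (_< suc (n ℕ./ suc M) ℕ.* suc M) (sym (m≡m%n+[m/n]*n n (suc M))) (ℕₚ.+-monoˡ-< (n ℕ./ suc M ℕ.* suc M) (m%n<n n (suc M))))
    (ℕₚ.*-monoˡ-≤ (suc M) n/<k)

∑-replicate-++ : ∀ {a} {A : Set a} k (y : A) xs g →
                 ∑ℚ-syntax (replicate k y ++ xs) g ≡ fromℕ k * g y + ∑ℚ-syntax xs g
∑-replicate-++ zero    y xs g = solve 2 (λ g s → s := con 0ℚ :* g :+ s) refl (g y) (∑ℚ-syntax xs g)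
∑-replicate-++ (suc k) y xs g = begin
  g y + ∑ℚ-syntax (replicate k y ++ xs) g      ≡⟨ cong (g y +_) (∑-replicate-++ k y xs g) ⟩
  g y + (fromℕ k * g y + ∑ℚ-syntax xs g)       ≡⟨ solve 3 (λ k g s → g :+ (k :* g :+ s) := (con 1ℚ :+ k) :* g :+ s) refl (fromℕ k) (g y) (∑ℚ-syntax xs g) ⟩
  (1ℚ + fromℕ k) * g y + ∑ℚ-syntax xs g        ≡⟨ cong (λ t → t * g y + ∑ℚ-syntax xs g) (fromℕ-suc k) ⟨
  fromℕ (suc k) * g y + ∑ℚ-syntax xs g         ∎
  where open ≡-Reasoning

-- The series of partitions weighted by length, with one part marked

module PowerSums (x : ℚ) where

  term : List ℕ → ℚ
  term μ = 1/z μ * x ^ length μ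

  -- The coefficients of the product of exp(x q^m / m) over m ≤ M. For n ≤ M they are the numbers H
  -- n.
  cycles : ℕ → ℕ → ℚ
  cycles M n = ∑ℚ[ μ ∈ partitionsUpTo M n ] term μ

  marked : (ℕ → ℚ) → ℕ → ℕ → ℚ
  marked g M n = ∑ℚ[ μ ∈ partitionsUpTo M n ] ∑ℚ-syntax μ g * term μ

  -- The coefficients of exp(x qᵐ / m) for m = suc M, as a series in qᵐ.
  expo : ℕ → ℕ → ℚ
  expo M k = 1/block M k * x ^ k

  -- The differential equation m E′ = x E of E(t) = exp(x t / m), read off coefficientwise.
  expo-suc : ∀ M k → expo M (suc k) * fromℕ (suc k) * fromℕ (suc M) ≡ x * expo M k
  expo-suc M k = begin
    1/block M (suc k) * (x * x ^ k) * fromℕ (suc k) * fromℕ (suc M)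
      ≡⟨ solve 5 (λ u x y k m → u :* (x :* y) :* k :* m := x :* ((u :* k :* m) :* y)) refl (1/block M (suc k)) x (x ^ k) (fromℕ (suc k)) (fromℕ (suc M)) ⟩
    x * ((1/block M (suc k) * fromℕ (suc k) * fromℕ (suc M)) * x ^ k)
      ≡⟨ cong (λ t → x * (t * x ^ k)) (1/block-suc M k) ⟩
    x * expo M k ∎
    where open ≡-Reasoning

  term-replicate-++ : ∀ k {M ν} → All (_≤ M) ν → term (replicate k (suc M) ++ ν) ≡ expo M k * term ν
  term-replicate-++ k {M} {ν} ν≤M = begin
    1/z μ * x ^ length μ
      ≡⟨ cong₂ _*_ (1/z-replicate-++ k ν≤M)
           (trans (cong (x ^_) (trans (Listₚ.length-++ (replicate k (suc M))) (cong (ℕ._+ length ν) (Listₚ.length-replicate k))))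
                  (^-homo-* x k (length ν))) ⟩
    (1/block M k * 1/z ν) * (x ^ k * x ^ length ν)
      ≡⟨ solve 4 (λ u v a b → (u :* v) :* (a :* b) := (u :* a) :* (v :* b)) refl (1/block M k) (1/z ν) (x ^ k) (x ^ length ν) ⟩
    expo M k * term ν ∎
    where
    open ≡-Reasoning
    μ : List ℕ
    μ = replicate k (suc M) ++ ν

  cycles-suc : ∀ M {n B} → n < B → cycles (suc M) n ≡ (∑ℚ[ k ∈ upTo B ] expo M k * shift (k ℕ.* suc M) (cycles M) n)
  cycles-suc M {n} {B} n<B = trans (∑-partitionsUpTo-suc M term n<B) (∑-cong (upTo B) (λ k → trans
    (shift-cong (k ℕ.* suc M) n (λ i _ → trans
      (∑-cong-All (All.map (term-replicate-++ k ∘ proj₁) (partitionsUpTo-sound M i)))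
      (∑-*ˡ (expo M k) (partitionsUpTo M i) term)))
    (shift-* (k ℕ.* suc M) (expo M k) (cycles M) n)))

  -- The Leibniz rule: the marked part is either one of the k copies of M + 1 or one of the smaller
  -- parts.
  marked-suc : ∀ g M {n B} → n < B → marked g (suc M) n
    ≡ (∑ℚ[ k ∈ upTo B ] expo M k * (fromℕ k * g (suc M)) * shift (k ℕ.* suc M) (cycles M) n)
    + (∑ℚ[ k ∈ upTo B ] expo M k * shift (k ℕ.* suc M) (marked g M) n)
  marked-suc g M {n} {B} n<B = begin
    marked g (suc M) n
      ≡⟨ ∑-partitionsUpTo-suc M (λ μ → ∑ℚ-syntax μ g * term μ) n<B ⟩
    (∑ℚ[ k ∈ upTo B ] shift (k ℕ.* suc M) (Φ k) n)
      ≡⟨ ∑-cong (upTo B) (λ k → begin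
           shift (k ℕ.* suc M) (Φ k) n
             ≡⟨ shift-cong (k ℕ.* suc M) n (λ i _ → Φ≡ k i) ⟩
           shift (k ℕ.* suc M) (λ i → u k * cycles M i + expo M k * marked g M i) n
             ≡⟨ shift-distrib-+ (k ℕ.* suc M) (λ i → u k * cycles M i) (λ i → expo M k * marked g M i) n ⟩
           shift (k ℕ.* suc M) (λ i → u k * cycles M i) n + shift (k ℕ.* suc M) (λ i → expo M k * marked g M i) n
             ≡⟨ cong₂ _+_ (shift-* (k ℕ.* suc M) (u k) (cycles M) n) (shift-* (k ℕ.* suc M) (expo M k) (marked g M) n) ⟩
           u k * shift (k ℕ.* suc M) (cycles M) n + expo M k * shift (k ℕ.* suc M) (marked g M) n ∎) ⟩
    (∑ℚ[ k ∈ upTo B ] u k * shift (k ℕ.* suc M) (cycles M) n + expo M k * shift (k ℕ.* suc M) (marked g M) n)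
      ≡⟨ ∑-+ (upTo B) (λ k → u k * shift (k ℕ.* suc M) (cycles M) n) (λ k → expo M k * shift (k ℕ.* suc M) (marked g M) n) ⟩
    (∑ℚ[ k ∈ upTo B ] u k * shift (k ℕ.* suc M) (cycles M) n)
      + (∑ℚ[ k ∈ upTo B ] expo M k * shift (k ℕ.* suc M) (marked g M) n) ∎
    where
    open ≡-Reasoning
    u : ℕ → ℚ
    u k = expo M k * (fromℕ k * g (suc M))
    Φ : ℕ → ℕ → ℚ
    Φ k i = ∑ℚ[ ν ∈ partitionsUpTo M i ] ∑ℚ-syntax (replicate k (suc M) ++ ν) g * term (replicate k (suc M) ++ ν)
    block : ∀ k {ν} → All (_≤ M) ν → ∑ℚ-syntax (replicate k (suc M) ++ ν) g * term (replicate k (suc M) ++ ν)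
                                   ≡ u k * term ν + expo M k * (∑ℚ-syntax ν g * term ν)
    block k {ν} ν≤M = trans (cong₂ _*_ (∑-replicate-++ k (suc M) ν g) (term-replicate-++ k ν≤M))
      (solve 4 (λ a s e t → (a :+ s) :* (e :* t) := (e :* a) :* t :+ e :* (s :* t)) refl (fromℕ k * g (suc M)) (∑ℚ-syntax ν g) (expo M k) (term ν))
    Φ≡ : ∀ k i → Φ k i ≡ u k * cycles M i + expo M k * marked g M i
    Φ≡ k i = begin
      Φ k i
        ≡⟨ ∑-cong-All (All.map (block k ∘ proj₁) (partitionsUpTo-sound M i)) ⟩
      (∑ℚ[ ν ∈ P ] u k * term ν + expo M k * (∑ℚ-syntax ν g * term ν))
        ≡⟨ ∑-+ P (λ ν → u k * term ν) (λ ν → expo M k * (∑ℚ-syntax ν g * term ν)) ⟩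
      (∑ℚ[ ν ∈ P ] u k * term ν) + (∑ℚ[ ν ∈ P ] expo M k * (∑ℚ-syntax ν g * term ν))
        ≡⟨ cong₂ _+_ (∑-*ˡ (u k) P term) (∑-*ˡ (expo M k) P (λ ν → ∑ℚ-syntax ν g * term ν)) ⟩
      u k * cycles M i + expo M k * marked g M i ∎
      where
      P : List (List ℕ)
      P = partitionsUpTo M i

  -- The exponential for M + 1 is multiplied back in. As the outer shift is at least 1, only indices
  -- strictly below n are read, so n terms suffice; `new` relies on this after losing its term k =
  -- 0.
  cycles-suc-shift : ∀ a M {n B} → n ≤ B →
    (∑ℚ[ k ∈ upTo B ] expo M k * shift (suc a) (shift (k ℕ.* suc M) (cycles M)) n) ≡ shift (suc a) (cycles (suc M)) n
  cycles-suc-shift a M {n} {B} n≤B = trans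
    (sym (shift-linear (suc a) (upTo B) (expo M) (λ k → shift (k ℕ.* suc M) (cycles M)) n))
    (shift-suc-cong a n (λ i i<n → sym (cycles-suc M (ℕₚ.<-≤-trans i<n n≤B))))

  -- The logarithmic derivative of the product, by induction on its number of factors. Here `c i` is
  -- g(m)/m for m = i + 1, given through a product so that no division occurs.
  marked-shift : ∀ {g} (c : ℕ → ℚ) → (∀ i → g (suc i) ≡ fromℕ (suc i) * c i) → ∀ M n →
                 marked g M n ≡ (∑ℚ[ i ∈ upTo M ] x * c i * shift (suc i) (cycles M) n)
  marked-shift c g≡ zero    zero    = refl
  marked-shift c g≡ zero    (suc n) = refl
  marked-shift {g} c g≡ (suc M) n   = begin
    marked g (suc M) n
      ≡⟨ marked-suc g M (ℕₚ.n<1+n n) ⟩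
    (∑ℚ[ k ∈ upTo (suc n) ] expo M k * (fromℕ k * g (suc M)) * shift (k ℕ.* suc M) (cycles M) n)
      + (∑ℚ[ k ∈ upTo (suc n) ] expo M k * shift (k ℕ.* suc M) (marked g M) n)
      ≡⟨ cong₂ _+_ new old ⟩
    x * c M * shift (suc M) (cycles (suc M)) n + (∑ℚ[ i ∈ upTo M ] x * c i * shift (suc i) (cycles (suc M)) n)
      ≡⟨ ℚₚ.+-comm (x * c M * shift (suc M) (cycles (suc M)) n) (∑ℚ[ i ∈ upTo M ] x * c i * shift (suc i) (cycles (suc M)) n) ⟩
    (∑ℚ[ i ∈ upTo M ] x * c i * shift (suc i) (cycles (suc M)) n) + x * c M * shift (suc M) (cycles (suc M)) n
      ≡⟨ ∑-upTo-∷ʳ M (λ i → x * c i * shift (suc i) (cycles (suc M)) n) ⟨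
    (∑ℚ[ i ∈ upTo (suc M) ] x * c i * shift (suc i) (cycles (suc M)) n) ∎
    where
    open ≡-Reasoning

    F : ℕ → ℕ → ℚ
    F k = shift (k ℕ.* suc M) (cycles M)

    -- A marked copy of M + 1 is taken out: the differential equation lowers k by one, and the freed
    -- q^(M+1) becomes the outer shift.
    new-term : ∀ k → expo M (suc k) * (fromℕ (suc k) * g (suc M)) * F (suc k) n
                   ≡ x * c M * (expo M k * shift (suc M) (F k) n)
    new-term k = begin
      expo M (suc k) * (fromℕ (suc k) * g (suc M)) * F (suc k) n
        ≡⟨ cong₂ (λ t u → expo M (suc k) * (fromℕ (suc k) * t) * u) (g≡ M) (shift-+ (suc M) (k ℕ.* suc M) (cycles M) n) ⟩
      expo M (suc k) * (fromℕ (suc k) * (fromℕ (suc M) * c M)) * shift (suc M) (F k) n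
        ≡⟨ solve 5 (λ e k m c s → e :* (k :* (m :* c)) :* s := (e :* k :* m) :* (c :* s)) refl (expo M (suc k)) (fromℕ (suc k)) (fromℕ (suc M)) (c M) (shift (suc M) (F k) n) ⟩
      (expo M (suc k) * fromℕ (suc k) * fromℕ (suc M)) * (c M * shift (suc M) (F k) n)
        ≡⟨ cong (_* (c M * shift (suc M) (F k) n)) (expo-suc M k) ⟩
      (x * expo M k) * (c M * shift (suc M) (F k) n)
        ≡⟨ solve 4 (λ x e c s → (x :* e) :* (c :* s) := x :* c :* (e :* s)) refl x (expo M k) (c M) (shift (suc M) (F k) n) ⟩
      x * c M * (expo M k * shift (suc M) (F k) n) ∎

    new : (∑ℚ[ k ∈ upTo (suc n) ] expo M k * (fromℕ k * g (suc M)) * F k n) ≡ x * c M * shift (suc M) (cycles (suc M)) n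
    new = begin
      (∑ℚ[ k ∈ upTo (suc n) ] expo M k * (fromℕ k * g (suc M)) * F k n)
        ≡⟨ ∑-upTo-suc n (λ k → expo M k * (fromℕ k * g (suc M)) * F k n) ⟩
      expo M 0 * (0ℚ * g (suc M)) * cycles M n + (∑ℚ[ k ∈ upTo n ] expo M (suc k) * (fromℕ (suc k) * g (suc M)) * F (suc k) n)
        ≡⟨ cong₂ _+_ (solve 3 (λ e g h → e :* (con 0ℚ :* g) :* h := con 0ℚ) refl (expo M 0) (g (suc M)) (cycles M n)) (∑-cong (upTo n) new-term) ⟩
      0ℚ + (∑ℚ[ k ∈ upTo n ] x * c M * (expo M k * shift (suc M) (F k) n))
        ≡⟨ trans (ℚₚ.+-identityˡ (∑ℚ[ k ∈ upTo n ] x * c M * (expo M k * shift (suc M) (F k) n))) (∑-*ˡ (x * c M) (upTo n) (λ k → expo M k * shift (suc M) (F k) n)) ⟩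
      x * c M * (∑ℚ[ k ∈ upTo n ] expo M k * shift (suc M) (F k) n)
        ≡⟨ cong (x * c M *_) (cycles-suc-shift M M {n} {n} ℕₚ.≤-refl) ⟩
      x * c M * shift (suc M) (cycles (suc M)) n ∎

    -- By induction the mark on a smaller part is already a shift of `cycles M`. Shifts commute, so
    -- the factor for M + 1 passes inside and completes `cycles M` to `cycles (suc M)`.
    old : (∑ℚ[ k ∈ upTo (suc n) ] expo M k * shift (k ℕ.* suc M) (marked g M) n)
        ≡ (∑ℚ[ i ∈ upTo M ] x * c i * shift (suc i) (cycles (suc M)) n)
    old = begin
      (∑ℚ[ k ∈ upTo (suc n) ] expo M k * shift (k ℕ.* suc M) (marked g M) n)
        ≡⟨ ∑-cong (upTo (suc n)) old-term ⟩
      (∑ℚ[ k ∈ upTo (suc n) ] ∑ℚ[ i ∈ upTo M ] x * c i * (expo M k * shift (suc i) (F k) n))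
        ≡⟨ ∑-swap (upTo (suc n)) (upTo M) (λ k i → x * c i * (expo M k * shift (suc i) (F k) n)) ⟩
      (∑ℚ[ i ∈ upTo M ] ∑ℚ[ k ∈ upTo (suc n) ] x * c i * (expo M k * shift (suc i) (F k) n))
        ≡⟨ ∑-cong (upTo M) (λ i → trans (∑-*ˡ (x * c i) (upTo (suc n)) (λ k → expo M k * shift (suc i) (F k) n))
             (cong (x * c i *_) (cycles-suc-shift i M {n} {suc n} (ℕₚ.n≤1+n n)))) ⟩
      (∑ℚ[ i ∈ upTo M ] x * c i * shift (suc i) (cycles (suc M)) n) ∎
      where
      old-term : ∀ k → expo M k * shift (k ℕ.* suc M) (marked g M) n
                     ≡ (∑ℚ[ i ∈ upTo M ] x * c i * (expo M k * shift (suc i) (F k) n))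
      old-term k = begin
        expo M k * shift (k ℕ.* suc M) (marked g M) n
          ≡⟨ cong (expo M k *_) (trans (shift-cong (k ℕ.* suc M) n (λ i _ → marked-shift c g≡ M i))
               (shift-linear (k ℕ.* suc M) (upTo M) (λ i → x * c i) (λ i → shift (suc i) (cycles M)) n)) ⟩
        expo M k * (∑ℚ[ i ∈ upTo M ] x * c i * shift (k ℕ.* suc M) (shift (suc i) (cycles M)) n)
          ≡⟨ ∑-*ˡ (expo M k) (upTo M) (λ i → x * c i * shift (k ℕ.* suc M) (shift (suc i) (cycles M)) n) ⟨
        (∑ℚ[ i ∈ upTo M ] expo M k * (x * c i * shift (k ℕ.* suc M) (shift (suc i) (cycles M)) n))
          ≡⟨ ∑-cong (upTo M) (λ i → trans
               (cong (λ t → expo M k * (x * c i * t)) (shift-comm (k ℕ.* suc M) (suc i) (cycles M) n))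
               (solve 3 (λ e u s → e :* (u :* s) := u :* (e :* s)) refl (expo M k) (x * c i) (shift (suc i) (F k) n))) ⟩
        (∑ℚ[ i ∈ upTo M ] x * c i * (expo M k * shift (suc i) (F k) n)) ∎

  marked-conv : ∀ {g} (c : ℕ → ℚ) → (∀ i → g (suc i) ≡ fromℕ (suc i) * c i) → ∀ {M n} → n < M →
                marked g M (suc n) ≡ x * conv c (cycles M) n
  marked-conv {g} c g≡ {M} {n} n<M = begin
    marked g M (suc n)
      ≡⟨ marked-shift c g≡ M (suc n) ⟩
    (∑ℚ[ i ∈ upTo M ] x * c i * shift i (cycles M) n)
      ≡⟨ ∑-upTo-extend (λ i → x * c i * shift i (cycles M) n) n<M
           (λ i n<i → trans (cong (x * c i *_) (shift-> i (cycles M) n<i)) (ℚₚ.*-zeroʳ (x * c i))) ⟨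
    (∑ℚ[ i ∈ upTo (suc n) ] x * c i * shift i (cycles M) n)
      ≡⟨ ∑-upTo-cong (suc n) (λ i i<1+n → trans
           (cong (x * c i *_) (shift-≤ i (cycles M) (ℕ.s≤s⁻¹ i<1+n)))
           (ℚₚ.*-assoc x (c i) (cycles M (n ∸ i)))) ⟩
    (∑ℚ[ i ∈ upTo (suc n) ] x * (c i * cycles M (n ∸ i)))
      ≡⟨ ∑-*ˡ x (upTo (suc n)) (λ i → c i * cycles M (n ∸ i)) ⟩
    x * conv c (cycles M) n ∎
    where open ≡-Reasoning

  ∑-fromℕ : ∀ μ → ∑ℚ-syntax μ fromℕ ≡ fromℕ (sum μ)
  ∑-fromℕ []      = refl
  ∑-fromℕ (m ∷ μ) = trans (cong (fromℕ m +_) (∑-fromℕ μ)) (sym (fromℕ-+ m (sum μ)))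

  marked-fromℕ : ∀ M n → marked fromℕ M n ≡ fromℕ n * cycles M n
  marked-fromℕ M n = trans
    (∑-cong-All (All.map (λ {μ} (_ , eq) → cong (_* term μ) (trans (∑-fromℕ μ) (cong fromℕ eq))) (partitionsUpTo-sound M n)))
    (∑-*ˡ (fromℕ n) (partitionsUpTo M n) term)

  cycles-0 : ∀ M → cycles M 0 ≡ 1ℚ
  cycles-0 zero    = refl
  cycles-0 (suc M) = begin
    cycles (suc M) 0                ≡⟨ cycles-suc M {0} {1} (s≤s z≤n) ⟩
    1ℚ * 1ℚ * cycles M 0 + 0ℚ       ≡⟨ solve 1 (λ h → con 1ℚ :* con 1ℚ :* h :+ con 0ℚ := h) refl (cycles M 0) ⟩
    cycles M 0                      ≡⟨ cycles-0 M ⟩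
    1ℚ                              ∎
    where open ≡-Reasoning

module _ (a : ℕ) where

  open PowerSums (fromℕ (suc a))

  -- A strong induction on n with M fixed: the recurrence calls every smaller index, and `N` is the
  -- decreasing bound.
  cycles-bin : ∀ {M} N {n} → n ≤ N → N ≤ M → cycles M n ≡ bin (n ℕ.+ a) a
  cycles-bin {M} N       {zero}  n≤N       N≤M = trans (cycles-0 M) (sym (bin-n-n a))
  cycles-bin {M} (suc N) {suc n} (s≤s n≤N) N<M = fromℕ-cancel (suc n) (begin
    fromℕ (suc n) * cycles M (suc n)
      ≡⟨ marked-fromℕ M (suc n) ⟨
    marked fromℕ M (suc n)
      -- For g(m) = m the quotient g(m)/m is 1, written `bin i 0` so that the convolution is the
      -- case K = 0 of `parallel-vandermonde`.
      ≡⟨ marked-conv (λ i → bin i 0) (λ i → sym (ℚₚ.*-identityʳ (fromℕ (suc i)))) (ℕₚ.≤-<-trans n≤N N<M) ⟩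
    fromℕ (suc a) * conv (λ i → bin i 0) (cycles M) n
      ≡⟨ cong (fromℕ (suc a) *_) (conv-congʳ (λ i → bin i 0) {cycles M} {λ i → bin (i ℕ.+ a) a} n (λ i i≤n → cycles-bin N (ℕₚ.≤-trans i≤n n≤N) (ℕₚ.<⇒≤ N<M))) ⟩
    fromℕ (suc a) * conv (λ i → bin i 0) (λ i → bin (i ℕ.+ a) a) n
      ≡⟨ cong (fromℕ (suc a) *_) (parallel-vandermonde 0 a n) ⟩
    fromℕ (suc a) * bin (suc n ℕ.+ a) (suc a)
      ≡⟨ bin-absorb (suc n ℕ.+ a) a ⟩
    (fromℕ (suc n ℕ.+ a) - fromℕ a) * bin (suc n ℕ.+ a) a
      ≡⟨ cong (_* bin (suc n ℕ.+ a) a) (trans (cong (_- fromℕ a) (fromℕ-+ (suc n) a))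
           (solve 2 (λ n a → n :+ a :- a := n) refl (fromℕ (suc n)) (fromℕ a))) ⟩
    fromℕ (suc n) * bin (suc n ℕ.+ a) a ∎)
    where open ≡-Reasoning

-- Both sides at a positive integer

conv-linearˡ : ∀ {b} {B : Set b} (xs : List B) (c : B → ℚ) (F : B → ℕ → ℚ) g n →
               conv (λ i → ∑ℚ[ x ∈ xs ] c x * F x i) g n ≡ (∑ℚ[ x ∈ xs ] c x * conv (F x) g n)
conv-linearˡ xs c F g n = begin
  (∑ℚ[ i ∈ upTo (suc n) ] (∑ℚ[ x ∈ xs ] c x * F x i) * g (n ∸ i))
    ≡⟨ ∑-cong (upTo (suc n)) (λ i → begin
         (∑ℚ[ x ∈ xs ] c x * F x i) * g (n ∸ i)
           ≡⟨ ℚₚ.*-comm (∑ℚ[ x ∈ xs ] c x * F x i) (g (n ∸ i)) ⟩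
         g (n ∸ i) * (∑ℚ[ x ∈ xs ] c x * F x i)
           ≡⟨ ∑-*ˡ (g (n ∸ i)) xs (λ x → c x * F x i) ⟨
         (∑ℚ[ x ∈ xs ] g (n ∸ i) * (c x * F x i))
           ≡⟨ ∑-cong xs (λ x → solve 3 (λ g c F → g :* (c :* F) := c :* (F :* g)) refl (g (n ∸ i)) (c x) (F x i)) ⟩
         (∑ℚ[ x ∈ xs ] c x * (F x i * g (n ∸ i))) ∎) ⟩
  (∑ℚ[ i ∈ upTo (suc n) ] ∑ℚ[ x ∈ xs ] c x * (F x i * g (n ∸ i)))
    ≡⟨ ∑-swap (upTo (suc n)) xs (λ i x → c x * (F x i * g (n ∸ i))) ⟩
  (∑ℚ[ x ∈ xs ] ∑ℚ[ i ∈ upTo (suc n) ] c x * (F x i * g (n ∸ i)))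
    ≡⟨ ∑-cong xs (λ x → ∑-*ˡ (c x) (upTo (suc n)) (λ i → F x i * g (n ∸ i))) ⟩
  (∑ℚ[ x ∈ xs ] c x * conv (F x) g n) ∎
  where open ≡-Reasoning

module Evaluated (n r′ s a : ℕ) where

  open PowerSums (fromℕ (suc a))
  open Weights r′ s using (rising-*-rising)
  open ≡-Reasoning

  private
    r N : ℕ
    r = suc r′
    N = r ℕ.+ s

    x κ : ℚ
    x = fromℕ (suc a)
    κ = ℤ.+ (r ! ℕ.* s !) / N

    q f c : ℕ → ℚ
    q K = binom N s (suc K)
    f m = rising (fromℕ m) r * rising (fromℕ m) s
    c i = ∑ℚ[ K ∈ upTo N ] κ * q K * bin i K

    -- The summand in which both sides meet. Its lower index K + a + 1 is complementary to n - K
    -- when K ≤ n. For K > n this form is 0, as wanted, while C(n+a+1, n ∸ K) would truncate to 1.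
    T : ℕ → ℚ
    T K = q K * bin (suc (n ℕ.+ a)) (suc (K ℕ.+ a))

    f-suc : ∀ i → f (suc i) ≡ fromℕ (suc i) * c i
    f-suc i = fromℕ-cancel N (begin
      fromℕ N * f (suc i)
        ≡⟨ rising-*-rising i ⟩
      fromℕ (suc i) * (fromℕ (r ! ℕ.* s !) * Q)
        ≡⟨ cong (λ t → fromℕ (suc i) * (t * Q)) (/-*-fromℕ (r ! ℕ.* s !) N) ⟨
      fromℕ (suc i) * (κ * fromℕ N * Q)
        ≡⟨ solve 4 (λ i κ N Q → i :* (κ :* N :* Q) := N :* (i :* (κ :* Q))) refl (fromℕ (suc i)) κ (fromℕ N) Q ⟩
      fromℕ N * (fromℕ (suc i) * (κ * Q))
        ≡⟨ cong (λ t → fromℕ N * (fromℕ (suc i) * t)) (trans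
             (∑-cong (upTo N) (λ K → ℚₚ.*-assoc κ (q K) (bin i K)))
             (∑-*ˡ κ (upTo N) (λ K → q K * bin i K))) ⟨
      fromℕ N * (fromℕ (suc i) * c i) ∎)
      where
      Q : ℚ
      Q = ∑ℚ[ K ∈ upTo N ] q K * bin i K

  marked-value : marked f (suc n) (suc n) ≡ x * (κ * (∑ℚ[ K ∈ upTo N ] T K))
  marked-value = begin
    marked f (suc n) (suc n)
      ≡⟨ marked-conv {f} c f-suc {suc n} {n} ℕₚ.≤-refl ⟩
    x * conv c (cycles (suc n)) n
      ≡⟨ cong (x *_) (conv-congʳ c {cycles (suc n)} {h} n (λ i i≤n → cycles-bin a {suc n} n {i} i≤n (ℕₚ.n≤1+n n))) ⟩
    x * conv c h n
      ≡⟨ cong (x *_) (conv-linearˡ (upTo N) (λ K → κ * q K) (λ K i → bin i K) h n) ⟩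
    x * (∑ℚ[ K ∈ upTo N ] κ * q K * conv (λ i → bin i K) h n)
      ≡⟨ cong (x *_) (∑-cong (upTo N) (λ K → trans
           (cong (κ * q K *_) (parallel-vandermonde K a n))
           (ℚₚ.*-assoc κ (q K) (bin (suc (n ℕ.+ a)) (suc (K ℕ.+ a)))))) ⟩
    x * (∑ℚ[ K ∈ upTo N ] κ * T K)
      ≡⟨ cong (x *_) (∑-*ˡ κ (upTo N) T) ⟩
    x * (κ * (∑ℚ[ K ∈ upTo N ] T K)) ∎
    where
    h : ℕ → ℚ
    h i = bin (i ℕ.+ a) a

  lhs : ℚ[X]
  lhs = ∑[ μ ∈ partitions (suc n) ] (1/z μ * ∑ℚ-syntax μ f) · X ^ₚ (length μ ∸ 1)

  eval-lhs : x * eval lhs x ≡ marked f (suc n) (suc n)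
  eval-lhs = begin
    x * eval lhs x
      ≡⟨ cong (x *_) (eval-∑ P (λ μ → (1/z μ * ∑ℚ-syntax μ f) · X ^ₚ (length μ ∸ 1)) x) ⟩
    x * (∑ℚ[ μ ∈ P ] eval ((1/z μ * ∑ℚ-syntax μ f) · X ^ₚ (length μ ∸ 1)) x)
      ≡⟨ ∑-*ˡ x P (λ μ → eval ((1/z μ * ∑ℚ-syntax μ f) · X ^ₚ (length μ ∸ 1)) x) ⟨
    (∑ℚ[ μ ∈ P ] x * eval ((1/z μ * ∑ℚ-syntax μ f) · X ^ₚ (length μ ∸ 1)) x)
      ≡⟨ ∑-cong-All (All.map (λ {μ} → summand μ ∘ proj₂) (partitionsUpTo-sound (suc n) (suc n))) ⟩
    marked f (suc n) (suc n) ∎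
    where
    P : List (List ℕ)
    P = partitions (suc n)
    summand : ∀ μ → sum μ ≡ suc n →
              x * eval ((1/z μ * ∑ℚ-syntax μ f) · X ^ₚ (length μ ∸ 1)) x ≡ ∑ℚ-syntax μ f * term μ
    -- The weight `suc n` excludes the empty partition. For the others `length μ ∸ 1` is a true
    -- difference, and the factor x restores the exponent `length μ`.
    summand μ@(m ∷ ν) _ = begin
      x * eval ((1/z μ * S) · X ^ₚ length ν) x
        ≡⟨ cong (x *_) (trans (eval-· (1/z μ * S) (X ^ₚ length ν) x) (cong (1/z μ * S *_) (eval-X^ (length ν) x))) ⟩
      x * (1/z μ * S * x ^ length ν)
        ≡⟨ solve 4 (λ x z S y → x :* (z :* S :* y) := S :* (z :* (x :* y))) refl x (1/z μ) S (x ^ length ν) ⟩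
      S * term μ ∎
      where
      S : ℚ
      S = ∑ℚ-syntax μ f

  Y : ℚ[X]
  Y = X ⊕ const (fromℕ (suc n)) ⊖ const (fromℕ 1)

  rhs : ℚ[X]
  rhs = κ · (∑[ k ∈ range₁ (suc n ⊓ N) ] binom N s k · choose Y (suc n ∸ k))

  eval-Y : eval Y x ≡ fromℕ (suc (n ℕ.+ a))
  eval-Y = begin
    eval Y x
      ≡⟨ eval-⊕ (X ⊕ const (fromℕ (suc n))) (⊖ const 1ℚ) x ⟩
    eval (X ⊕ const (fromℕ (suc n))) x + eval (⊖ const 1ℚ) x
      ≡⟨ cong₂ _+_ (trans (eval-⊕ X (const (fromℕ (suc n))) x) (cong₂ _+_ (eval-X x) (eval-const (fromℕ (suc n)) x)))
                   (trans (eval-⊖ (const 1ℚ) x) (cong -_ (eval-const 1ℚ x))) ⟩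
    x + fromℕ (suc n) - 1ℚ
      ≡⟨ cong (_- 1ℚ) (trans (sym (fromℕ-+ (suc a) (suc n))) (trans (cong fromℕ (ℕₚ.+-comm (suc a) (suc n)))
           (trans (cong fromℕ (ℕₚ.+-suc (suc n) a)) (fromℕ-suc (suc n ℕ.+ a))))) ⟩
    1ℚ + fromℕ (suc (n ℕ.+ a)) - 1ℚ
      ≡⟨ solve 1 (λ t → con 1ℚ :+ t :- con 1ℚ := t) refl (fromℕ (suc (n ℕ.+ a))) ⟩
    fromℕ (suc (n ℕ.+ a)) ∎

  eval-rhs : eval rhs x ≡ κ * (∑ℚ[ K ∈ upTo N ] T K)
  eval-rhs = begin
    eval rhs x
      ≡⟨ eval-· κ (∑-syntax (range₁ (suc n ⊓ N)) g) x ⟩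
    κ * eval (∑-syntax (range₁ (suc n ⊓ N)) g) x
      ≡⟨ cong (κ *_) (begin
           eval (∑-syntax (range₁ (suc n ⊓ N)) g) x
             ≡⟨ eval-∑ (range₁ (suc n ⊓ N)) g x ⟩
           (∑ℚ[ k ∈ range₁ (suc n ⊓ N) ] eval (g k) x)
             ≡⟨ ∑-range₁ (suc n ⊓ N) (λ k → eval (g k) x) ⟩
           (∑ℚ[ K ∈ upTo (suc n ⊓ N) ] eval (g (suc K)) x)
             ≡⟨ ∑-upTo-cong (suc n ⊓ N) (λ K K< → trans
                  (eval-· (q K) (choose Y (n ∸ K)) x)
                  (cong (q K *_) (trans (eval-choose Y x (suc (n ℕ.+ a)) (n ∸ K) eval-Y)
                                        (complement (ℕ.s≤s⁻¹ (ℕₚ.≤-trans K< (ℕₚ.m⊓n≤m (suc n) N))))))) ⟩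
           (∑ℚ[ K ∈ upTo (suc n ⊓ N) ] T K)
             ≡⟨ ∑-upTo-extend T (ℕₚ.m⊓n≤n (suc n) N) vanish ⟩
           (∑ℚ[ K ∈ upTo N ] T K) ∎) ⟩
    κ * (∑ℚ[ K ∈ upTo N ] T K) ∎
    where
    g : ℕ → ℚ[X]
    g k = binom N s k · choose Y (suc n ∸ k)

    complement : ∀ {K} → K ≤ n → bin (suc (n ℕ.+ a)) (n ∸ K) ≡ bin (suc (n ℕ.+ a)) (suc (K ℕ.+ a))
    complement {K} K≤n = subst (λ t → bin t (n ∸ K) ≡ bin t (suc (K ℕ.+ a))) total (bin-sym (n ∸ K) (suc (K ℕ.+ a)))
      where
      total : (n ∸ K) ℕ.+ suc (K ℕ.+ a) ≡ suc (n ℕ.+ a)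
      total = trans (ℕₚ.+-suc (n ∸ K) (K ℕ.+ a))
        (cong suc (trans (sym (ℕₚ.+-assoc (n ∸ K) K a)) (cong (ℕ._+ a) (ℕₚ.m∸n+n≡m K≤n))))

    -- The two bounds in the minimum have different sources: past n the binomial in `T` vanishes,
    -- past r + s the weight `binom` does.
    vanish : ∀ K → suc n ⊓ N ≤ K → T K ≡ 0ℚ
    vanish K ⊓≤K = [ (λ ⊓≡n → n<K (subst (_≤ K) ⊓≡n ⊓≤K)) , (λ ⊓≡N → N≤K (subst (_≤ K) ⊓≡N ⊓≤K)) ]′ (ℕₚ.⊓-sel (suc n) N)
      where
      n<K : n < K → T K ≡ 0ℚ
      n<K n<K = trans (cong (q K *_) (bin-> {suc (n ℕ.+ a)} {suc (K ℕ.+ a)} (s≤s (ℕₚ.+-monoˡ-< a n<K)))) (ℚₚ.*-zeroʳ (q K))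
      N≤K : N ≤ K → T K ≡ 0ℚ
      N≤K N≤K = trans (cong (_* bin (suc (n ℕ.+ a)) (suc (K ℕ.+ a)))
                        (binom-> N s (s≤s N≤K)))
                      (ℚₚ.*-zeroˡ (bin (suc (n ℕ.+ a)) (suc (K ℕ.+ a))))

  evals-agree : eval lhs x ≡ eval rhs x
  evals-agree = fromℕ-cancel (suc a) (begin
    x * eval lhs x                       ≡⟨ eval-lhs ⟩
    marked f (suc n) (suc n)             ≡⟨ marked-value ⟩
    x * (κ * (∑ℚ[ K ∈ upTo N ] T K))     ≡⟨ cong (x *_) eval-rhs ⟨
    x * eval rhs x                       ∎)

theorem4 : ∀ (n r s : ℕ) .{{_ : NonZero n}} .{{_ : NonZero r}} .{{_ : NonZero s}} →
    let instance
          r+s-nonZero : NonZero (r ℕ.+ s)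
          r+s-nonZero = +-nonZero r s
    in
    (∑[ μ ∈ partitions n ]
       (1/z μ * (∑ℚ[ m ∈ μ ] rising (fromℕ m) r * rising (fromℕ m) s))
         · X ^ₚ (length μ ∸ 1))
    ≈
    (ℤ.+ (r ! ℕ.* s !) / (r ℕ.+ s)) ·
      (∑[ k ∈ range₁ (n ⊓ (r ℕ.+ s)) ]
         binom (r ℕ.+ s) s k · choose (X ⊕ const (fromℕ n) ⊖ const (fromℕ 1)) (n ∸ k))
theorem4 zero    r       s = contradiction refl (ℕ.≢-nonZero⁻¹ 0)
theorem4 (suc n) zero    s = contradiction refl (ℕ.≢-nonZero⁻¹ 0)
-- The polynomials `lhs` and `rhs` do not depend on the evaluation point, so the argument 0 for `a`
-- is a placeholder; only `evals-agree` ranges over all `a`.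
theorem4 (suc n) (suc r) s = eval-injective (Evaluated.lhs n r s 0) (Evaluated.rhs n r s 0) (Evaluated.evals-agree n r s)
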